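{- Let $n\ge -1$ and let $\Gamma\Rightarrow\Pi$ be a sequent with $\Gamma\cup\Pi\subseteq\mathsf{Fm}$. If $\mathbf{LIP}_{n+1}\vdash\Gamma\Rightarrow\Pi$, then $\mathbf{LI}\vdash^{cf}\Gamma\Rightarrow\Pi$.
   Context: Fix a language $L$ of first order function and predicate symbols, a countable set of term variables $x,y,\dots$ and a countable set of (unary) set variables $X,Y,\dots$. Second order formulas: $\varphi,\psi ::= p(\vec t)\mid X(t)\mid \bot\mid \varphi\star\psi\mid Qx.\varphi\mid QX.\varphi$ with $p\in L$, terms $t$ over $L$, $\star\in\{\wedge,\vee,\rightarrow\}$, $Q\in\{\forall,\exists\}$. $\mathsf{FV}$ and $\mathsf{Fv}$ denote the sets of free set variables and free term variables. $\alpha$-equivalent formulas are identified. An abstract is an expression $\tau=\lambda x.\varphi$, with $\tau(t):=\varphi(t)$; $\varphi(\tau)$ is obtained from $\varphi(X)$ by replacing each atom $X(t)$ (free $X$) by $\tau(t)$. $\mathsf{FMP}_{ -1}=\mathsf{Fm}$ is the set of formulas without second order quantifiers (free set variables allowed). For $n\ge 0$, $\mathsf{FMP}_n$ is given by $\varphi,\psi ::= p(\vec t)\mid X(t)\mid \bot\mid\varphi\star\psi\mid Qx.\varphi\mid QX.\xi$, where $\xi\in\mathsf{FMP}_{n-1}$ and $\mathsf{FV}(\xi)\subseteq\{X\}$. Sequents $\Gamma\Rightarrow\Pi$: $\Gamma$ is a finite set of formulas, $\Pi$ is empty or a singleton; $\Gamma,\Delta$ means $\Gamma\cup\Delta$.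 Rules: (id) $\Gamma,\varphi\Rightarrow\varphi$. (cut) from $\Gamma\Rightarrow\varphi$ and $\varphi,\Gamma\Rightarrow\Pi$ infer $\Gamma\Rightarrow\Pi$. ($\bot$) $\bot,\Gamma\Rightarrow\Pi$; from $\Gamma\Rightarrow$ infer $\Gamma\Rightarrow\bot$. ($\wedge$) from $\varphi_i,\Gamma\Rightarrow\Pi$ ($i=1$ or $2$) infer $\varphi_1\wedge\varphi_2,\Gamma\Rightarrow\Pi$; from $\Gamma\Rightarrow\varphi_1$ and $\Gamma\Rightarrow\varphi_2$ infer $\Gamma\Rightarrow\varphi_1\wedge\varphi_2$. ($\vee$) from $\varphi_1,\Gamma\Rightarrow\Pi$ and $\varphi_2,\Gamma\Rightarrow\Pi$ infer $\varphi_1\vee\varphi_2,\Gamma\Rightarrow\Pi$; from $\Gamma\Rightarrow\varphi_i$ infer $\Gamma\Rightarrow\varphi_1\vee\varphi_2$. ($\rightarrow$) from $\Gamma\Rightarrow\varphi_1$ and $\varphi_2,\Gamma\Rightarrow\Pi$ infer $\varphi_1\rightarrow\varphi_2,\Gamma\Rightarrow\Pi$; from $\varphi_1,\Gamma\Rightarrow\varphi_2$ infer $\Gamma\Rightarrow\varphi_1\rightarrow\varphi_2$. ($\forall x$) from $\varphi(t),\Gamma\Rightarrow\Pi$ infer $\forall x.\varphi(x),\Gamma\Rightarrow\Pi$; from $\Gamma\Rightarrow\varphi(y)$ with $y\notin\mathsf{Fv}(\Gamma)$ infer $\Gamma\Rightarrow\forall x.\varphi(x)$. ($\exists x$) from $\varphi(y),\Gamma\Rightarrow\Pi$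 with $y\notin\mathsf{Fv}(\Gamma,\Pi)$ infer $\exists x.\varphi(x),\Gamma\Rightarrow\Pi$; from $\Gamma\Rightarrow\varphi(t)$ infer $\Gamma\Rightarrow\exists x.\varphi(x)$. ($\forall X$) from $\varphi(\tau),\Gamma\Rightarrow\Pi$ ($\tau$ an abstract) infer $\forall X.\varphi(X),\Gamma\Rightarrow\Pi$; from $\Gamma\Rightarrow\varphi(Y)$ with $Y\notin\mathsf{FV}(\Gamma)$ infer $\Gamma\Rightarrow\forall X.\varphi(X)$. ($\exists X$) from $\varphi(Y),\Gamma\Rightarrow\Pi$ with $Y\notin\mathsf{FV}(\Gamma,\Pi)$ infer $\exists X.\varphi(X),\Gamma\Rightarrow\Pi$; from $\Gamma\Rightarrow\varphi(\tau)$ infer $\Gamma\Rightarrow\exists X.\varphi(X)$. $\mathbf{LIP}_n$ ($n\ge 0$) is the calculus with all these rules in which all formulas in a derivation belong to $\mathsf{FMP}_n$. $\mathbf{LI}$ is the calculus in which all formulas belong to $\mathsf{Fm}$ and the rules ($\forall X$), ($\exists X$) are omitted. $\vdash$ denotes derivability and $\vdash^{cf}$ derivability without (cut). -}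

module Defs where

open import Data.Nat using (ℕ; zero; suc)
open import Data.Fin using (Fin; zero; suc)
open import Data.Vec as Vec using (Vec; []; _∷_)
import Data.Vec.Relation.Unary.Any as VecAny
open import Data.List using (List; []; _∷_)
open import Data.List.Relation.Unary.All using (All)
open import Data.List.Relation.Binary.BagAndSetEquality using (_∼[_]_; set)
open import Data.Maybe using (Maybe; just; nothing)
import Data.Maybe.Relation.Unary.All as MaybeAll
open import Data.Product using (_×_)
open import Data.Sum using (_⊎_)
open import Relation.Binary.PropositionalEquality using (_≡_)
open import Relation.Nullary using (¬_)

record Language : Set₁ where
  field
    Function       : Set
    functionArity  : Function → ℕ
    Predicate      : Set
    predicateArity : Predicate → ℕ

-- Locally nameless syntax: free variables of either sort are named by natural
-- numbers and bound ones are well-scoped de Bruijn indices, so α-equivalent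
-- formulas are equal.
data Var (m : ℕ) : Set where
  free  : ℕ → Var m
  bound : Fin m → Var m

wkVar : ∀ {m} → Var m → Var (suc m)
wkVar (free x)  = free x
wkVar (bound i) = bound (suc i)

module SecondOrder (L : Language) where
  open Language L

  infixr 8 _∧_
  infixr 7 _∨_
  infixr 6 _⊃_
  infix  4 _∈ᵗ_ _∈Fv_ _∈FV_ _≈_
  infix  3 _⇒_
  infix  2 _⊢_ _⊢ᶜᶠ_

  data Term (m : ℕ) : Set where
    var : Var m → Term m
    fun : (f : Function) → Vec (Term m) (functionArity f) → Term m

  data Connective : Set where
    conj disj impl : Connective

  data Quantifier : Set where
    univ exis : Quantifier

  -- In Form m k there are m enclosing term binders and k enclosing set binders
  -- whose variables may be referred to by bound.
  data Form (m k : ℕ) : Set where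
    pred  : (p : Predicate) → Vec (Term m) (predicateArity p) → Form m k
    app   : Var k → Term m → Form m k
    ⊥     : Form m k
    conn  : Connective → Form m k → Form m k → Form m k
    quan₁ : Quantifier → Form (suc m) k → Form m k
    quan₂ : Quantifier → Form m (suc k) → Form m k

  pattern _∧_ φ ψ = conn conj φ ψ
  pattern _∨_ φ ψ = conn disj φ ψ
  pattern _⊃_ φ ψ = conn impl φ ψ
  pattern ∀₁ φ    = quan₁ univ φ
  pattern ∃₁ φ    = quan₁ exis φ
  pattern ∀₂ φ    = quan₂ univ φ
  pattern ∃₂ φ    = quan₂ exis φ

  Formula : Set
  Formula = Form 0 0

  -- λx.φ, with x as index zero of φ.
  Abs : ℕ → ℕ → Set
  Abs m k = Form (suc m) k

  data _∈ᵗ_ {m} (x : Var m) : Term m → Set where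
    var : x ∈ᵗ var x
    fun : ∀ {f ts} → VecAny.Any (x ∈ᵗ_) ts → x ∈ᵗ fun f ts

  data _∈Fv_ {m k} (x : Var m) : Form m k → Set where
    pred  : ∀ {p ts} → VecAny.Any (x ∈ᵗ_) ts → x ∈Fv pred p ts
    app   : ∀ {X t} → x ∈ᵗ t → x ∈Fv app X t
    left  : ∀ {c φ ψ} → x ∈Fv φ → x ∈Fv conn c φ ψ
    right : ∀ {c φ ψ} → x ∈Fv ψ → x ∈Fv conn c φ ψ
    quan₁ : ∀ {q φ} → wkVar x ∈Fv φ → x ∈Fv quan₁ q φ
    quan₂ : ∀ {q φ} → x ∈Fv φ → x ∈Fv quan₂ q φ

  data _∈FV_ {m k} (X : Var k) : Form m k → Set where
    app   : ∀ {t} → X ∈FV app X t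
    left  : ∀ {c φ ψ} → X ∈FV φ → X ∈FV conn c φ ψ
    right : ∀ {c φ ψ} → X ∈FV ψ → X ∈FV conn c φ ψ
    quan₁ : ∀ {q φ} → X ∈FV φ → X ∈FV quan₁ q φ
    quan₂ : ∀ {q φ} → wkVar X ∈FV φ → X ∈FV quan₂ q φ

  -- FMP i is FMP_{i-1}, so that FMP 0 = FMP_{-1} = Fm.  The hypothesis of quan₂
  -- on set variables says FV(ξ) ⊆ {X}, X being the variable bound here.
  data FMP : ℕ → ∀ {m k} → Form m k → Set where
    pred  : ∀ {i m k p ts} → FMP i {m} {k} (pred p ts)
    app   : ∀ {i m k X t} → FMP i {m} {k} (app X t)
    ⊥     : ∀ {i m k} → FMP i {m} {k} ⊥
    conn  : ∀ {i m k c} {φ ψ : Form m k} → FMP i φ → FMP i ψ → FMP i (conn c φ ψ)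
    quan₁ : ∀ {i m k q} {φ : Form (suc m) k} → FMP i φ → FMP i (quan₁ q φ)
    quan₂ : ∀ {i m k q} {ξ : Form m (suc k)} → FMP i ξ →
            (∀ Y → Y ∈FV ξ → Y ≡ bound zero) → FMP (suc i) (quan₂ q ξ)

  Fm : ∀ {m k} → Form m k → Set
  Fm = FMP 0

  Subst₁ : ℕ → ℕ → Set
  Subst₁ m m′ = Fin m → Term m′

  mutual
    substTerm : ∀ {m m′} → Subst₁ m m′ → Term m → Term m′
    substTerm σ (var (free x))  = var (free x)
    substTerm σ (var (bound i)) = σ i
    substTerm σ (fun f ts)      = fun f (substTerms σ ts)

    substTerms : ∀ {m m′ a} → Subst₁ m m′ → Vec (Term m) a → Vec (Term m′) a
    substTerms σ []       = []
    substTerms σ (t ∷ ts) = substTerm σ t ∷ substTerms σ ts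

  shift₁ : ∀ {m} → Subst₁ m (suc m)
  shift₁ i = var (bound (suc i))

  lift₁ : ∀ {m m′} → Subst₁ m m′ → Subst₁ (suc m) (suc m′)
  lift₁ σ zero    = var (bound zero)
  lift₁ σ (suc i) = substTerm shift₁ (σ i)

  subst₁ : ∀ {m m′ k} → Subst₁ m m′ → Form m k → Form m′ k
  subst₁ σ (pred p ts)  = pred p (substTerms σ ts)
  subst₁ σ (app X t)    = app X (substTerm σ t)
  subst₁ σ ⊥            = ⊥
  subst₁ σ (conn c φ ψ) = conn c (subst₁ σ φ) (subst₁ σ ψ)
  subst₁ σ (quan₁ q φ)  = quan₁ q (subst₁ (lift₁ σ) φ)
  subst₁ σ (quan₂ q φ)  = quan₂ q (subst₁ σ φ)

  single₁ : ∀ {m} → Term m → Subst₁ (suc m) m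
  single₁ t zero    = t
  single₁ t (suc i) = var (bound i)

  _[_]₁ : ∀ {m k} → Form (suc m) k → Term m → Form m k
  φ [ t ]₁ = subst₁ (single₁ t) φ

  renVar : ∀ {k k′} → (Fin k → Fin k′) → Var k → Var k′
  renVar ρ (free X)  = free X
  renVar ρ (bound i) = bound (ρ i)

  liftRen : ∀ {k k′} → (Fin k → Fin k′) → Fin (suc k) → Fin (suc k′)
  liftRen ρ zero    = zero
  liftRen ρ (suc i) = suc (ρ i)

  ren₂ : ∀ {m k k′} → (Fin k → Fin k′) → Form m k → Form m k′
  ren₂ ρ (pred p ts)  = pred p ts
  ren₂ ρ (app X t)    = app (renVar ρ X) t
  ren₂ ρ ⊥            = ⊥
  ren₂ ρ (conn c φ ψ) = conn c (ren₂ ρ φ) (ren₂ ρ ψ)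
  ren₂ ρ (quan₁ q φ)  = quan₁ q (ren₂ ρ φ)
  ren₂ ρ (quan₂ q φ)  = quan₂ q (ren₂ (liftRen ρ) φ)

  Subst₂ : ℕ → ℕ → ℕ → Set
  Subst₂ m k k′ = Fin k → Abs m k′

  -- λx.X(x), as an abstract.
  ηAbs : ∀ {m k} → Var k → Abs m k
  ηAbs X = app X (var (bound zero))

  under₁ : ∀ {m k k′} → Subst₂ m k k′ → Subst₂ (suc m) k k′
  under₁ σ i = subst₁ (lift₁ shift₁) (σ i)

  lift₂ : ∀ {m k k′} → Subst₂ m k k′ → Subst₂ m (suc k) (suc k′)
  lift₂ σ zero    = ηAbs (bound zero)
  lift₂ σ (suc i) = ren₂ suc (σ i)

  subst₂ : ∀ {m k k′} → Subst₂ m k k′ → Form m k → Form m k′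
  subst₂ σ (pred p ts)       = pred p ts
  subst₂ σ (app (free X) t)  = app (free X) t
  subst₂ σ (app (bound i) t) = σ i [ t ]₁
  subst₂ σ ⊥                 = ⊥
  subst₂ σ (conn c φ ψ)      = conn c (subst₂ σ φ) (subst₂ σ ψ)
  subst₂ σ (quan₁ q φ)       = quan₁ q (subst₂ (under₁ σ) φ)
  subst₂ σ (quan₂ q φ)       = quan₂ q (subst₂ (lift₂ σ) φ)

  single₂ : ∀ {m k} → Abs m k → Subst₂ m (suc k) k
  single₂ τ zero    = τ
  single₂ τ (suc i) = ηAbs (bound i)

  _[_]₂ : ∀ {m k} → Form m (suc k) → Abs m k → Form m k
  φ [ τ ]₂ = subst₂ (single₂ τ) φ

  -- The antecedent represents a finite set; see _≈_ and Derivation.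
  data Sequent : Set where
    _⇒_ : List Formula → Maybe Formula → Sequent

  data _≈_ : Sequent → Sequent → Set where
    same : ∀ {Γ Δ Π} → Γ ∼[ set ] Δ → (Γ ⇒ Π) ≈ (Δ ⇒ Π)

  AllFormulas : (Formula → Set) → Sequent → Set
  AllFormulas P (Γ ⇒ Π) = All P Γ × MaybeAll.All P Π

  Fresh₁ Fresh₂ : ℕ → Sequent → Set
  Fresh₁ y = AllFormulas (λ φ → ¬ (free y ∈Fv φ))
  Fresh₂ Y = AllFormulas (λ φ → ¬ (free Y ∈FV φ))

  Rules : Set₁
  Rules = List Sequent → Sequent → Set

  -- Eigenvariables must be absent from the whole conclusion: ∀x.φ(x) is
  -- α-equivalent to ∀y.φ(y) only if y is not free in it.
  data Basic : Rules where
    id  : ∀ {Γ φ} → Basic [] (φ ∷ Γ ⇒ just φ)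
    ⊥L  : ∀ {Γ Π} → Basic [] (⊥ ∷ Γ ⇒ Π)
    ⊥R  : ∀ {Γ} → Basic ((Γ ⇒ nothing) ∷ []) (Γ ⇒ just ⊥)
    ∧L₁ : ∀ {Γ Π φ ψ} → Basic ((φ ∷ Γ ⇒ Π) ∷ []) (φ ∧ ψ ∷ Γ ⇒ Π)
    ∧L₂ : ∀ {Γ Π φ ψ} → Basic ((ψ ∷ Γ ⇒ Π) ∷ []) (φ ∧ ψ ∷ Γ ⇒ Π)
    ∧R  : ∀ {Γ φ ψ} →
          Basic ((Γ ⇒ just φ) ∷ (Γ ⇒ just ψ) ∷ []) (Γ ⇒ just (φ ∧ ψ))
    ∨L  : ∀ {Γ Π φ ψ} →
          Basic ((φ ∷ Γ ⇒ Π) ∷ (ψ ∷ Γ ⇒ Π) ∷ []) (φ ∨ ψ ∷ Γ ⇒ Π)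
    ∨R₁ : ∀ {Γ φ ψ} → Basic ((Γ ⇒ just φ) ∷ []) (Γ ⇒ just (φ ∨ ψ))
    ∨R₂ : ∀ {Γ φ ψ} → Basic ((Γ ⇒ just ψ) ∷ []) (Γ ⇒ just (φ ∨ ψ))
    ⊃L  : ∀ {Γ Π φ ψ} →
          Basic ((Γ ⇒ just φ) ∷ (ψ ∷ Γ ⇒ Π) ∷ []) (φ ⊃ ψ ∷ Γ ⇒ Π)
    ⊃R  : ∀ {Γ φ ψ} → Basic ((φ ∷ Γ ⇒ just ψ) ∷ []) (Γ ⇒ just (φ ⊃ ψ))
    ∀₁L : ∀ {Γ Π φ} t → Basic ((φ [ t ]₁ ∷ Γ ⇒ Π) ∷ []) (∀₁ φ ∷ Γ ⇒ Π)
    ∀₁R : ∀ {Γ φ} y → Fresh₁ y (Γ ⇒ just (∀₁ φ)) →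
          Basic ((Γ ⇒ just (φ [ var (free y) ]₁)) ∷ []) (Γ ⇒ just (∀₁ φ))
    ∃₁L : ∀ {Γ Π φ} y → Fresh₁ y (∃₁ φ ∷ Γ ⇒ Π) →
          Basic ((φ [ var (free y) ]₁ ∷ Γ ⇒ Π) ∷ []) (∃₁ φ ∷ Γ ⇒ Π)
    ∃₁R : ∀ {Γ φ} t → Basic ((Γ ⇒ just (φ [ t ]₁)) ∷ []) (Γ ⇒ just (∃₁ φ))

  data SetQuantifier : Rules where
    ∀₂L : ∀ {Γ Π φ} τ →
          SetQuantifier ((φ [ τ ]₂ ∷ Γ ⇒ Π) ∷ []) (∀₂ φ ∷ Γ ⇒ Π)
    ∀₂R : ∀ {Γ φ} Y → Fresh₂ Y (Γ ⇒ just (∀₂ φ)) →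
          SetQuantifier ((Γ ⇒ just (φ [ ηAbs (free Y) ]₂)) ∷ []) (Γ ⇒ just (∀₂ φ))
    ∃₂L : ∀ {Γ Π φ} Y → Fresh₂ Y (∃₂ φ ∷ Γ ⇒ Π) →
          SetQuantifier ((φ [ ηAbs (free Y) ]₂ ∷ Γ ⇒ Π) ∷ []) (∃₂ φ ∷ Γ ⇒ Π)
    ∃₂R : ∀ {Γ φ} τ →
          SetQuantifier ((Γ ⇒ just (φ [ τ ]₂)) ∷ []) (Γ ⇒ just (∃₂ φ))

  data Cut : Rules where
    cut : ∀ {Γ Π} φ → Cut ((Γ ⇒ just φ) ∷ (φ ∷ Γ ⇒ Π) ∷ []) (Γ ⇒ Π)

  _∪_ : Rules → Rules → Rules
  (R ∪ R′) Ss S = R Ss S ⊎ R′ Ss S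

  -- Every sequent of a derivation is the conclusion S of some inference, so the
  -- first argument forces all formulas in the derivation to satisfy P; the third
  -- makes derivability depend only on the set of formulas in an antecedent.
  data Derivation (P : Formula → Set) (R : Rules) : Sequent → Set where
    infer : ∀ {Ss S′ S} → AllFormulas P S → R Ss S′ → S′ ≈ S →
            All (Derivation P R) Ss → Derivation P R S

  record Calculus : Set₁ where
    field
      formulas     : Formula → Set
      cutFreeRules : Rules

  _⊢ᶜᶠ_ _⊢_ : Calculus → Sequent → Set
  C ⊢ᶜᶠ S = Derivation (Calculus.formulas C) (Calculus.cutFreeRules C) S
  C ⊢ S   = Derivation (Calculus.formulas C) (Calculus.cutFreeRules C ∪ Cut) S

  LI : Calculus
  LI = record { formulas = Fm ; cutFreeRules = Basic }

  LIP : ℕ → Calculus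
  LIP n = record { formulas = FMP (suc n) ; cutFreeRules = Basic ∪ SetQuantifier }

{-# OPTIONS --safe #-}
module Submission where

-- Buchholz's Ω-rule, used semantically.  A parameter-free ∀X.ξ of rank j + 1 is
-- understood through the antecedents Δ with Δ ⇒ ξ(Z) derivable in a cut-free
-- infinitary calculus D j for formulas of lower rank; dually, ∃X.ξ is understood
-- through the sequents Δ ⇒ Π with ξ(Z), Δ ⇒ Π derivable in D j.  The calculus D i
-- has Ω-rules with premises indexed by these Δ, for all j < i, and instances Ω̃ of
-- cut on ∀X.ξ or ∃X.ξ.  Over D i, formulas are interpreted by closed sets of
-- antecedents, set quantifiers by closing off the sets just described.  No
-- quantification over closed sets is needed, so that the interpretation is
-- predicative.  Comprehension for ∀X.ξ holds since D j ⊆ D i is itself sound: from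
-- Δ ⇒ ξ(Z) one gets ξ(C) for every closed C.  Hence LIP is sound, and reflection and
-- reification at the canonical valuation turn validity into derivability in D i.
-- Finally D (j + 1) collapses to D j on formulas of rank ≤ j: an instance of Ω̃
-- of rank j names, by its first premise, one of the indices of its other premises.

open import Defs
open import Data.Nat using (ℕ; zero; suc; _+_; _∸_; _≤_; _<_; _⊔_; z≤n; s≤s; s≤s⁻¹)
open import Data.Nat.Properties
  using (_≟_; _<?_; ≤-refl; ≤-trans; <⇒≤; m≤m⊔n; m≤n⊔m; ⊔-lub; n≮n; m⊔n≤o⇒m≤o; m⊔n≤o⇒n≤o;
         m<n⇒m<1+n; m+n≮m; m+n∸m≡n; ≤∧≢⇒<; m≤n⇒m<n∨m≡n)
open import Data.Fin using (zero; suc)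
open import Data.Vec using (Vec; []; _∷_)
import Data.Vec.Relation.Unary.Any as VecAny
open import Data.List using (List; []; _∷_; _++_; map)
open import Data.List.Properties using (map-id; map-cong; map-∘)
open import Data.List.Relation.Unary.All as All using (All; []; _∷_)
import Data.List.Relation.Unary.All.Properties as All
open import Data.List.Relation.Unary.Any using (here; there)
open import Data.List.Membership.Propositional using (_∈_)
open import Data.List.Membership.Propositional.Properties using (∈-++⁻)
open import Data.List.Relation.Binary.Subset.Propositional using (_⊆_)
open import Data.List.Relation.Binary.Subset.Propositional.Properties
  using (⊆-refl; ⊆-reflexive; ⊆-trans; ∷⁺ʳ; xs⊆xs++ys; xs⊆ys++xs)
open import Data.Maybe as Maybe using (Maybe; just; nothing)
import Data.Maybe.Relation.Unary.All as MaybeAll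
open import Data.Empty using () renaming (⊥ to Empty)
open import Data.Product using (∃; _×_; _,_; proj₁; proj₂)
open import Data.Sum using (_⊎_; inj₁; inj₂; [_,_])
open import Function using (_∘_; mk⇔; Equivalence) renaming (id to identity)
open import Relation.Nullary using (¬_; yes; no; contradiction)
open import Relation.Binary.PropositionalEquality
  using (_≡_; refl; sym; trans; cong; cong₂; subst; _≗_)
  renaming (subst₂ to subst₂≡)

-- Environments over free and bound variables

infixl 5 _▹_

_▹_ : ∀ {ℓ} {A : Set ℓ} {m} → (Var m → A) → A → Var (suc m) → A
(f ▹ a) (free x)        = f (free x)
(f ▹ a) (bound zero)    = a
(f ▹ a) (bound (suc i)) = f (bound i)

-- Free names and outer indices behave alike under a binder; the view merges them into one case,
-- leaving only the new index apart.
data View {m} : Var (suc m) → Set where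
  top : View (bound zero)
  wk  : ∀ x → View (wkVar x)

view : ∀ {m} (x : Var (suc m)) → View x
view (free x)        = wk (free x)
view (bound zero)    = top
view (bound (suc i)) = wk (bound i)

▹-wk : ∀ {ℓ} {A : Set ℓ} {m} (f : Var m → A) a x → (f ▹ a) (wkVar x) ≡ f x
▹-wk f a (free x)  = refl
▹-wk f a (bound i) = refl

upd : ∀ {ℓ} {A : Set ℓ} → (Var 0 → A) → ℕ → A → Var 0 → A
upd f z a (free x) with x ≟ z
... | yes _ = a
... | no  _ = f (free x)

upd-same : ∀ {ℓ} {A : Set ℓ} (f : Var 0 → A) z a → upd f z a (free z) ≡ a
upd-same f z a with z ≟ z
... | yes _   = refl
... | no z≢z = contradiction refl z≢z

-- `P` will be occurrence in a formula, so that eigenvariables of both sorts are covered.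
upd-fresh : ∀ {ℓ} {A : Set ℓ} (P : Var 0 → Set) {f : Var 0 → A} {z a x} →
            ¬ P (free z) → P x → upd f z a x ≡ f x
upd-fresh P {z = z} {x = free x} ¬p p with x ≟ z
... | yes refl = contradiction p ¬p
... | no  _    = refl

module Development (L : Language) where
  open SecondOrder L

  -- Simultaneous substitution

  wkTerm : ∀ {m} → Var m → Term (suc m)
  wkTerm = var ∘ wkVar

  mutual
    subTerm : ∀ {m m′} → (Var m → Term m′) → Term m → Term m′
    subTerm σ (var x)    = σ x
    subTerm σ (fun f ts) = fun f (subTerms σ ts)

    subTerms : ∀ {m m′ a} → (Var m → Term m′) → Vec (Term m) a → Vec (Term m′) a
    subTerms σ []       = []
    subTerms σ (t ∷ ts) = subTerm σ t ∷ subTerms σ ts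

  liftTerm : ∀ {m m′} → (Var m → Term m′) → Var (suc m) → Term (suc m′)
  liftTerm σ = (subTerm wkTerm ∘ σ) ▹ var (bound zero)

  liftVar : ∀ {k k′} → (Var k → Var k′) → Var (suc k) → Var (suc k′)
  liftVar θ = (wkVar ∘ θ) ▹ bound zero

  -- A common form of `subst₁`, of renaming free set variables and of opening bodies. Set variables
  -- go to set variables only, so composing two such maps involves no abstracts.
  sub : ∀ {m m′ k k′} → (Var m → Term m′) → (Var k → Var k′) → Form m k → Form m′ k′
  sub σ θ (pred p ts)  = pred p (subTerms σ ts)
  sub σ θ (app X t)    = app (θ X) (subTerm σ t)
  sub σ θ ⊥            = ⊥
  sub σ θ (conn c φ ψ) = conn c (sub σ θ φ) (sub σ θ ψ)
  sub σ θ (quan₁ q φ)  = quan₁ q (sub (liftTerm σ) θ φ)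
  sub σ θ (quan₂ q φ)  = quan₂ q (sub σ (liftVar θ) φ)

  mutual
    subTerm-∘ : ∀ {m m′ m″} {σ : Var m → Term m′} {σ′ : Var m′ → Term m″} {σ″} t →
                (∀ x → x ∈ᵗ t → subTerm σ′ (σ x) ≡ σ″ x) →
                subTerm σ′ (subTerm σ t) ≡ subTerm σ″ t
    subTerm-∘ (var x)    h = h x var
    subTerm-∘ (fun f ts) h = cong (fun f) (subTerms-∘ ts (λ x → h x ∘ fun))

    subTerms-∘ : ∀ {m m′ m″ a} {σ : Var m → Term m′} {σ′ : Var m′ → Term m″} {σ″}
                 (ts : Vec (Term m) a) →
                 (∀ x → VecAny.Any (x ∈ᵗ_) ts → subTerm σ′ (σ x) ≡ σ″ x) →
                 subTerms σ′ (subTerms σ ts) ≡ subTerms σ″ ts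
    subTerms-∘ []       h = refl
    subTerms-∘ (t ∷ ts) h = cong₂ _∷_ (subTerm-∘ t (λ x → h x ∘ VecAny.here))
                                      (subTerms-∘ ts (λ x → h x ∘ VecAny.there))

  mutual
    subTerm-id : ∀ {m} {τ : Var m → Term m} t → τ ≗ var → subTerm τ t ≡ t
    subTerm-id (var x)    e = e x
    subTerm-id (fun f ts) e = cong (fun f) (subTerms-id ts e)

    subTerms-id : ∀ {m a} {τ : Var m → Term m} (ts : Vec (Term m) a) →
                  τ ≗ var → subTerms τ ts ≡ ts
    subTerms-id []       e = refl
    subTerms-id (t ∷ ts) e = cong₂ _∷_ (subTerm-id t e) (subTerms-id ts e)

  mutual
    substTerm-sub : ∀ {m m′} {σ : Subst₁ m m′} {τ : Var m → Term m′} t →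
                    (∀ x → τ (free x) ≡ var (free x)) → (∀ i → τ (bound i) ≡ σ i) →
                    substTerm σ t ≡ subTerm τ t
    substTerm-sub (var (free x))  f b = sym (f x)
    substTerm-sub (var (bound i)) f b = sym (b i)
    substTerm-sub (fun g ts)      f b = cong (fun g) (substTerms-sub ts f b)

    substTerms-sub : ∀ {m m′ a} {σ : Subst₁ m m′} {τ : Var m → Term m′}
                     (ts : Vec (Term m) a) →
                     (∀ x → τ (free x) ≡ var (free x)) → (∀ i → τ (bound i) ≡ σ i) →
                     substTerms σ ts ≡ subTerms τ ts
    substTerms-sub []       f b = refl
    substTerms-sub (t ∷ ts) f b = cong₂ _∷_ (substTerm-sub t f b) (substTerms-sub ts f b)

  liftTerm-∘ : ∀ {m m′ m″} {σ : Var m → Term m′} {σ′ : Var m′ → Term m″} {σ″} {x} →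
               subTerm σ′ (σ x) ≡ σ″ x →
               subTerm (liftTerm σ′) (liftTerm σ (wkVar x)) ≡ liftTerm σ″ (wkVar x)
  liftTerm-∘ {σ = σ} {σ′} {σ″} {x} e = begin
    subTerm (liftTerm σ′) (liftTerm σ (wkVar x)) ≡⟨ cong (subTerm _) (▹-wk _ _ x) ⟩
    subTerm (liftTerm σ′) (subTerm wkTerm (σ x)) ≡⟨ subTerm-∘ (σ x) (λ y _ → ▹-wk _ _ y) ⟩
    subTerm (subTerm wkTerm ∘ σ′) (σ x)          ≡⟨ subTerm-∘ (σ x) (λ _ _ → refl) ⟨
    subTerm wkTerm (subTerm σ′ (σ x))            ≡⟨ cong (subTerm wkTerm) e ⟩
    subTerm wkTerm (σ″ x)                        ≡⟨ ▹-wk _ _ x ⟨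
    liftTerm σ″ (wkVar x)                        ∎
    where open Relation.Binary.PropositionalEquality.≡-Reasoning

  sub-∘ : ∀ {m m′ m″ k k′ k″} {σ : Var m → Term m′} {σ′ : Var m′ → Term m″} {σ″}
          {θ : Var k → Var k′} {θ′ : Var k′ → Var k″} {θ″} φ →
          (∀ x → x ∈Fv φ → subTerm σ′ (σ x) ≡ σ″ x) →
          (∀ X → X ∈FV φ → θ′ (θ X) ≡ θ″ X) →
          sub σ′ θ′ (sub σ θ φ) ≡ sub σ″ θ″ φ
  sub-∘ (pred p ts) h H = cong (pred p) (subTerms-∘ ts (λ x → h x ∘ pred))
  sub-∘ (app X t) h H = cong₂ app (H X app) (subTerm-∘ t (λ x → h x ∘ app))
  sub-∘ ⊥ h H = refl
  sub-∘ (conn c φ ψ) h H =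
    cong₂ (conn c) (sub-∘ φ (λ x → h x ∘ left) (λ X → H X ∘ left))
                   (sub-∘ ψ (λ x → h x ∘ right) (λ X → H X ∘ right))
  sub-∘ {σ = σ} {σ′} {σ″} (quan₁ q φ) h H =
    cong (quan₁ q) (sub-∘ φ (λ x → lift (view x)) (λ X → H X ∘ quan₁))
    where
    lift : ∀ {x} → View x → x ∈Fv φ →
           subTerm (liftTerm σ′) (liftTerm σ x) ≡ liftTerm σ″ x
    lift top    _ = refl
    lift (wk x) p = liftTerm-∘ {σ = σ} {σ′} {σ″} (h x (quan₁ p))
  sub-∘ {θ = θ} {θ′} {θ″} (quan₂ q φ) h H =
    cong (quan₂ q) (sub-∘ φ (λ x → h x ∘ quan₂) (λ X → lift (view X)))
    where
    lift : ∀ {X} → View X → X ∈FV φ → liftVar θ′ (liftVar θ X) ≡ liftVar θ″ X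
    lift top    _ = refl
    lift (wk X) p =
      trans (cong (liftVar θ′) (▹-wk _ _ X))
        (trans (▹-wk _ _ (θ X)) (trans (cong wkVar (H X (quan₂ p))) (sym (▹-wk _ _ X))))

  liftTerm-id : ∀ {m} {τ : Var m → Term m} → τ ≗ var → liftTerm τ ≗ var
  liftTerm-id {τ = τ} e x = lift (view x)
    where
    lift : ∀ {x} → View x → liftTerm τ x ≡ var x
    lift top    = refl
    lift (wk x) = trans (▹-wk _ _ x) (cong (subTerm wkTerm) (e x))

  liftVar-id : ∀ {k} {θ : Var k → Var k} → θ ≗ identity → liftVar θ ≗ identity
  liftVar-id {θ = θ} e X = lift (view X)
    where
    lift : ∀ {X} → View X → liftVar θ X ≡ X
    lift top    = refl
    lift (wk X) = trans (▹-wk _ _ X) (cong wkVar (e X))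

  subst₁-sub : ∀ {m m′ k} {σ : Subst₁ m m′} {τ : Var m → Term m′} {θ : Var k → Var k} φ →
               (∀ x → τ (free x) ≡ var (free x)) → (∀ i → τ (bound i) ≡ σ i) →
               θ ≗ identity → subst₁ σ φ ≡ sub τ θ φ
  subst₁-sub (pred p ts) f b e = cong (pred p) (substTerms-sub ts f b)
  subst₁-sub (app X t) f b e = cong₂ app (sym (e X)) (substTerm-sub t f b)
  subst₁-sub ⊥ f b e = refl
  subst₁-sub (conn c φ ψ) f b e = cong₂ (conn c) (subst₁-sub φ f b e) (subst₁-sub ψ f b e)
  subst₁-sub {σ = σ} {τ} (quan₁ q φ) f b e =
    cong (quan₁ q) (subst₁-sub φ (cong (subTerm wkTerm) ∘ f) lift e)
    where
    lift : ∀ i → liftTerm τ (bound i) ≡ lift₁ σ i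
    lift zero    = refl
    lift (suc i) = trans (cong (subTerm wkTerm) (b i))
                         (sym (substTerm-sub (σ i) (λ _ → refl) (λ _ → refl)))
  subst₁-sub (quan₂ q φ) f b e = cong (quan₂ q) (subst₁-sub φ f b (liftVar-id e))

  fullSubst : ∀ {m m′} → Subst₁ m m′ → Var m → Term m′
  fullSubst σ (free x)  = var (free x)
  fullSubst σ (bound i) = σ i

  subst₁≡sub : ∀ {m m′ k} (σ : Subst₁ m m′) (φ : Form m k) →
               subst₁ σ φ ≡ sub (fullSubst σ) identity φ
  subst₁≡sub σ φ = subst₁-sub φ (λ _ → refl) (λ _ → refl) (λ _ → refl)


  sub-id : ∀ {m k} {τ : Var m → Term m} {θ : Var k → Var k} φ →
           τ ≗ var → θ ≗ identity → sub τ θ φ ≡ φ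
  sub-id (pred p ts)  e E = cong (pred p) (subTerms-id ts e)
  sub-id (app X t)    e E = cong₂ app (E X) (subTerm-id t e)
  sub-id ⊥            e E = refl
  sub-id (conn c φ ψ) e E = cong₂ (conn c) (sub-id φ e E) (sub-id ψ e E)
  sub-id (quan₁ q φ)  e E = cong (quan₁ q) (sub-id φ (liftTerm-id e) E)
  sub-id (quan₂ q φ)  e E = cong (quan₂ q) (sub-id φ e (liftVar-id E))

  renVar-suc : ∀ {k} (X : Var k) → renVar suc X ≡ wkVar X
  renVar-suc (free x)  = refl
  renVar-suc (bound i) = refl

  -- An η-expanded variable applied to `t` computes to an atom. The conditions concern only
  -- variables that occur in `φ`, since parameter-freeness says nothing about the others.
  subst₂-η : ∀ {m k k′} {σ : Subst₂ m k k′} {τ : Var m → Term m} {θ : Var k → Var k′} φ →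
             τ ≗ var →
             (∀ x → free x ∈FV φ → θ (free x) ≡ free x) →
             (∀ i → bound i ∈FV φ → σ i ≡ ηAbs (θ (bound i))) →
             subst₂ σ φ ≡ sub τ θ φ
  subst₂-η (pred p ts) e f b = cong (pred p) (sym (subTerms-id ts e))
  subst₂-η (app (free x) t) e f b =
    cong₂ app (sym (f x app)) (sym (subTerm-id t e))
  subst₂-η (app (bound i) t) e f b =
    trans (cong (_[ t ]₁) (b i app)) (cong (app _) (sym (subTerm-id t e)))
  subst₂-η ⊥ e f b = refl
  subst₂-η (conn c φ ψ) e f b =
    cong₂ (conn c) (subst₂-η φ e (λ x → f x ∘ left) (λ i → b i ∘ left))
                   (subst₂-η ψ e (λ x → f x ∘ right) (λ i → b i ∘ right))
  subst₂-η (quan₁ q φ) e f b =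
    cong (quan₁ q) (subst₂-η φ (liftTerm-id e) (λ x → f x ∘ quan₁)
                     (λ i p → cong (subst₁ (lift₁ shift₁)) (b i (quan₁ p))))
  subst₂-η {σ = σ} {θ = θ} (quan₂ q φ) e f b =
    cong (quan₂ q) (subst₂-η φ e (λ x p → cong wkVar (f x (quan₂ p))) lift)
    where
    lift : ∀ i → bound i ∈FV φ → lift₂ σ i ≡ ηAbs (liftVar θ (bound i))
    lift zero    _ = refl
    lift (suc i) p = trans (cong (ren₂ suc) (b i (quan₂ p))) (cong ηAbs (renVar-suc (θ (bound i))))

  -- Rank and bodies of set quantifiers

  rank : ∀ {m k} → Form m k → ℕ
  rank (pred p ts)  = 0
  rank (app X t)    = 0
  rank ⊥            = 0
  rank (conn c φ ψ) = rank φ ⊔ rank ψ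
  rank (quan₁ q φ)  = rank φ
  rank (quan₂ q φ)  = suc (rank φ)

  rank-sub : ∀ {m m′ k k′} {σ : Var m → Term m′} {θ : Var k → Var k′} φ →
             rank (sub σ θ φ) ≡ rank φ
  rank-sub (pred p ts)  = refl
  rank-sub (app X t)    = refl
  rank-sub ⊥            = refl
  rank-sub (conn c φ ψ) = cong₂ _⊔_ (rank-sub φ) (rank-sub ψ)
  rank-sub (quan₁ q φ)  = rank-sub φ
  rank-sub (quan₂ q φ)  = cong suc (rank-sub φ)

  rank-subst₁ : ∀ {m m′ k} (σ : Subst₁ m m′) (φ : Form m k) → rank (subst₁ σ φ) ≡ rank φ
  rank-subst₁ σ φ = trans (cong rank (subst₁≡sub σ φ)) (rank-sub φ)

  FMP⇒rank≤ : ∀ {i m k} {φ : Form m k} → FMP i φ → rank φ ≤ i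
  FMP⇒rank≤ pred        = z≤n
  FMP⇒rank≤ app         = z≤n
  FMP⇒rank≤ ⊥           = z≤n
  FMP⇒rank≤ (conn a b)  = ⊔-lub (FMP⇒rank≤ a) (FMP⇒rank≤ b)
  FMP⇒rank≤ (quan₁ a)   = FMP⇒rank≤ a
  FMP⇒rank≤ (quan₂ a _) = s≤s (FMP⇒rank≤ a)

  -- All set variables are sent to `Z`. On a parameter-free body this is ξ(Z), and any earlier
  -- renaming of set variables is forgotten, so that no proof of parameter-freeness has to be
  -- carried along.
  opened : ∀ {m k} → (Var m → Term 0) → ℕ → Form m k → Formula
  opened ρ Z = sub ρ (λ _ → free Z)

  opened-sub : ∀ {m m′ k k′} {σ : Var m → Term m′} {θ : Var k → Var k′} {ρ : Var m′ → Term 0}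
               {ρ′} φ {Z} → (∀ x → x ∈Fv φ → subTerm ρ (σ x) ≡ ρ′ x) →
               opened ρ Z (sub σ θ φ) ≡ opened ρ′ Z φ
  opened-sub φ h = sub-∘ φ h (λ _ _ → refl)

  ParameterFree : ∀ {m k} → Form m (suc k) → Set
  ParameterFree ξ = ∀ Y → Y ∈FV ξ → Y ≡ bound zero

  -- The only set variable occurring in `ξ` is the one bound here, and `lift₂ σ` fixes it. The
  -- constant renaming expresses this although `k` and `k′` may differ.
  subst₂-parameterFree : ∀ {m k k′} {σ : Subst₂ m k k′} {ξ : Form m (suc k)} → ParameterFree ξ →
                         subst₂ (lift₂ σ) ξ ≡ sub var (λ _ → bound zero) ξ
  subst₂-parameterFree {σ = σ} {ξ} pf = subst₂-η ξ (λ _ → refl) (λ x p → absurd (pf _ p)) only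
    where
    absurd : ∀ {k k′ x} → free {suc k} x ≡ bound zero → bound {suc k′} zero ≡ free x
    absurd ()
    only : ∀ i → bound i ∈FV ξ → lift₂ σ i ≡ ηAbs (bound zero)
    only i p with refl ← pf _ p = refl

  -- The infinitary calculi

  Ctx Goal : Set
  Ctx  = List Formula
  Goal = Maybe Formula

  Calc : Set₁
  Calc = Ctx → Goal → Set

  Ranked : ℕ → Sequent → Set
  Ranked j = AllFormulas (λ φ → rank φ ≤ j)

  renFree : (Var 0 → Var 0) → Formula → Formula
  renFree π = sub var π

  FreshFor : ℕ → Formula → Set
  FreshFor Z φ = ¬ (free Z ∈FV φ)

  -- Free set variables cannot be replaced in a derivation with Ω-rules, whose
  -- premises contain arbitrary free variables.  Closing the indices of these
  -- premises under renamings π makes up for it: see aside.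
  data Wit∀ (R : Calc) (B : ℕ → Formula) : Ctx → Set where
    wit : ∀ {Γ} π Z → All (FreshFor Z) Γ → R Γ (just (B Z)) → Wit∀ R B (map (renFree π) Γ)

  data Wit∃ (R : Calc) (B : ℕ → Formula) : Calc where
    wit : ∀ {Γ Π} π Z → Fresh₂ Z (Γ ⇒ Π) → R (B Z ∷ Γ) Π →
          Wit∃ R B (map (renFree π) Γ) (Maybe.map (renFree π) Π)

  Wit∀-≗ : ∀ {R B B′ Γ} → B ≗ B′ → Wit∀ R B Γ → Wit∀ R B′ Γ
  Wit∀-≗ {R} e (wit {Γ} π Z f d) = wit π Z f (subst (R Γ ∘ just) (e Z) d)

  Wit∃-≗ : ∀ {R B B′ Γ Π} → B ≗ B′ → Wit∃ R B Γ Π → Wit∃ R B′ Γ Π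
  Wit∃-≗ {R} e (wit {Γ} {Π} π Z f d) = wit π Z f (subst (λ φ → R (φ ∷ Γ) Π) (e Z) d)

  Wit∀-cong : ∀ {R R′ B Γ} → R ≡ R′ → Wit∀ R B Γ → Wit∀ R′ B Γ
  Wit∀-cong refl w = w

  Wit∃-cong : ∀ {R R′ B Γ Π} → R ≡ R′ → Wit∃ R B Γ Π → Wit∃ R′ B Γ Π
  Wit∃-cong refl w = w

  -- P j stands for D j when j < i.  The rules ∀₁R and ∃₁L have one premise per term
  -- instead of an eigenvariable, so that free term variables act as constants: an
  -- instance of the premises of an Ω-rule under a substitution for term variables
  -- need not be among the premises.
  data Der (i : ℕ) (P : ℕ → Calc) : Calc where
    weaken : ∀ {Γ Δ Π} → Γ ⊆ Δ → Der i P Γ Π → Der i P Δ Π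
    id  : ∀ {Γ φ} → φ ∈ Γ → Der i P Γ (just φ)
    ⊥L  : ∀ {Γ Π} → ⊥ ∈ Γ → Der i P Γ Π
    ∧L₁ : ∀ {Γ Π φ ψ} → φ ∧ ψ ∈ Γ → Der i P (φ ∷ Γ) Π → Der i P Γ Π
    ∧L₂ : ∀ {Γ Π φ ψ} → φ ∧ ψ ∈ Γ → Der i P (ψ ∷ Γ) Π → Der i P Γ Π
    ∧R  : ∀ {Γ φ ψ} → Der i P Γ (just φ) → Der i P Γ (just ψ) → Der i P Γ (just (φ ∧ ψ))
    ∨L  : ∀ {Γ Π φ ψ} → φ ∨ ψ ∈ Γ → Der i P (φ ∷ Γ) Π → Der i P (ψ ∷ Γ) Π → Der i P Γ Π
    ∨R₁ : ∀ {Γ φ ψ} → Der i P Γ (just φ) → Der i P Γ (just (φ ∨ ψ))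
    ∨R₂ : ∀ {Γ φ ψ} → Der i P Γ (just ψ) → Der i P Γ (just (φ ∨ ψ))
    ⊃L  : ∀ {Γ Π φ ψ} → φ ⊃ ψ ∈ Γ → Der i P Γ (just φ) → Der i P (ψ ∷ Γ) Π → Der i P Γ Π
    ⊃R  : ∀ {Γ φ ψ} → Der i P (φ ∷ Γ) (just ψ) → Der i P Γ (just (φ ⊃ ψ))
    ∀₁L : ∀ {Γ Π φ} → ∀₁ φ ∈ Γ → ∀ t → Der i P (φ [ t ]₁ ∷ Γ) Π → Der i P Γ Π
    ∀₁R : ∀ {Γ φ} → (∀ t → Der i P Γ (just (φ [ t ]₁))) → Der i P Γ (just (∀₁ φ))
    ∃₁L : ∀ {Γ Π φ} → ∃₁ φ ∈ Γ → (∀ t → Der i P (φ [ t ]₁ ∷ Γ) Π) → Der i P Γ Π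
    ∃₁R : ∀ {Γ φ} t → Der i P Γ (just (φ [ t ]₁)) → Der i P Γ (just (∃₁ φ))
    ∀₂R : ∀ {Γ Δ ξ} → rank ξ < i → Wit∀ (Der i P) (λ Z → opened var Z ξ) Δ → Δ ⊆ Γ →
          Der i P Γ (just (∀₂ ξ))
    Ω∀  : ∀ {Γ Π ξ} → rank ξ < i → ∀₂ ξ ∈ Γ →
          (∀ {Δ} → All (λ φ → rank φ ≤ rank ξ) Δ →
             Wit∀ (P (rank ξ)) (λ Z → opened var Z ξ) Δ → Der i P (Δ ++ Γ) Π) →
          Der i P Γ Π
    -- The membership in `Ω∀` is replaced by a witness for the quantified formula, which is thereby
    -- cut. The body stays open under `ρ`, the form in which the interpretation meets it.
    Ω̃∀  : ∀ {m k Γ Δ Π} (ξ : Form m (suc k)) ρ → rank ξ < i →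
          Wit∀ (Der i P) (λ Z → opened ρ Z ξ) Δ → Δ ⊆ Γ →
          (∀ {Δ} → All (λ φ → rank φ ≤ rank ξ) Δ →
             Wit∀ (P (rank ξ)) (λ Z → opened ρ Z ξ) Δ → Der i P (Δ ++ Γ) Π) →
          Der i P Γ Π
    ∃₂L : ∀ {Γ Δ Π ξ} → rank ξ < i → ∃₂ ξ ∈ Γ →
          Wit∃ (Der i P) (λ Z → opened var Z ξ) Δ Π → Δ ⊆ Γ → Der i P Γ Π
    Ω∃  : ∀ {Γ ξ} → rank ξ < i →
          (∀ {Δ Π} → Ranked (rank ξ) (Δ ⇒ Π) →
             Wit∃ (P (rank ξ)) (λ Z → opened var Z ξ) Δ Π → Der i P (Δ ++ Γ) Π) →
          Der i P Γ (just (∃₂ ξ))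
    Ω̃∃  : ∀ {m k Γ Δ Π} (ξ : Form m (suc k)) ρ → rank ξ < i →
          (∀ {Δ Π} → Ranked (rank ξ) (Δ ⇒ Π) →
             Wit∃ (P (rank ξ)) (λ Z → opened ρ Z ξ) Δ Π → Der i P (Δ ++ Γ) Π) →
          Wit∃ (Der i P) (λ Z → opened ρ Z ξ) Δ Π → Δ ⊆ Γ → Der i P Γ Π

  -- Ω-rules use the lower calculi negatively, so no single inductive family would be strictly
  -- positive: `Der` takes them as a parameter and the knot is tied by recursion on `i`. For `j ≥ i`
  -- the value is empty, a default, as the rules ask for `rank ξ < i`.
  Prev : ℕ → ℕ → Calc
  Prev zero    j = λ _ _ → Empty
  Prev (suc i) j with j ≟ i
  ... | yes _ = Der i (Prev i)
  ... | no  _ = Prev i j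

  D : ℕ → Calc
  D i = Der i (Prev i)

  Prev-top : ∀ i → Prev (suc i) i ≡ D i
  Prev-top i with i ≟ i
  ... | yes _ = refl
  ... | no ¬p = contradiction refl ¬p

  Prev-step : ∀ {i j} → j < i → Prev (suc i) j ≡ Prev i j
  Prev-step {i} {j} j<i with j ≟ i
  ... | yes refl = contradiction j<i (n≮n j)
  ... | no  _    = refl

  -- Inclusion of the calculi and collapsing

  raise : ∀ {i j Γ} → j ≤ i → All (λ (φ : Formula) → rank φ ≤ j) Γ → All (λ φ → rank φ ≤ i) Γ
  raise j≤i = All.map (λ q → ≤-trans q j≤i)

  raiseᴳ : ∀ {i j Π} → j ≤ i → MaybeAll.All (λ (φ : Formula) → rank φ ≤ j) Π →
           MaybeAll.All (λ φ → rank φ ≤ i) Π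
  raiseᴳ j≤i = MaybeAll.map (λ q → ≤-trans q j≤i)

  ranked-renFree : ∀ {j π} {Γ : Ctx} → All (λ φ → rank φ ≤ j) (map (renFree π) Γ) →
                   All (λ φ → rank φ ≤ j) Γ
  ranked-renFree = All.map (λ {φ} → subst (_≤ _) (rank-sub φ)) ∘ All.map⁻

  ranked-renFreeᴳ : ∀ {j π} (Π : Goal) → MaybeAll.All (λ φ → rank φ ≤ j) (Maybe.map (renFree π) Π) →
                    MaybeAll.All (λ φ → rank φ ≤ j) Π
  ranked-renFreeᴳ (just φ) (MaybeAll.just r) = MaybeAll.just (subst (_≤ _) (rank-sub φ) r)
  ranked-renFreeᴳ nothing  _                 = MaybeAll.nothing

  rank-left : ∀ {j} (φ ψ : Formula) → rank φ ⊔ rank ψ ≤ j → rank φ ≤ j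
  rank-left φ ψ = m⊔n≤o⇒m≤o (rank φ) (rank ψ)

  rank-right : ∀ {j} (φ ψ : Formula) → rank φ ⊔ rank ψ ≤ j → rank ψ ≤ j
  rank-right φ ψ = m⊔n≤o⇒n≤o (rank φ) (rank ψ)

  rank-inst : ∀ {j} (φ : Form 1 0) t → rank φ ≤ j → rank (φ [ t ]₁) ≤ j
  rank-inst φ t = subst (_≤ _) (sym (rank-subst₁ _ φ))

  rank-opened : ∀ {j m k} {ρ : Var m → Term 0} (ξ : Form m k) Z →
                rank ξ ≤ j → rank (opened ρ Z ξ) ≤ j
  rank-opened ξ Z = subst (_≤ _) (sym (rank-sub ξ))

  mutual
    -- An Ω-rule available in `D i` has the same indices in `D (suc i)`, by `Prev-step`, so its
    -- family of premises can be kept.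
    up : ∀ {i Γ Π} → D i Γ Π → D (suc i) Γ Π
    up (weaken s d)   = weaken s (up d)
    up (id m)         = id m
    up (⊥L m)         = ⊥L m
    up (∧L₁ m d)      = ∧L₁ m (up d)
    up (∧L₂ m d)      = ∧L₂ m (up d)
    up (∧R d e)       = ∧R (up d) (up e)
    up (∨L m d e)     = ∨L m (up d) (up e)
    up (∨R₁ d)        = ∨R₁ (up d)
    up (∨R₂ d)        = ∨R₂ (up d)
    up (⊃L m d e)     = ⊃L m (up d) (up e)
    up (⊃R d)         = ⊃R (up d)
    up (∀₁L m t d)    = ∀₁L m t (up d)
    up (∀₁R d)        = ∀₁R (λ t → up (d t))
    up (∃₁L m d)      = ∃₁L m (λ t → up (d t))
    up (∃₁R t d)      = ∃₁R t (up d)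
    up (∀₂R r w s)    = ∀₂R (m<n⇒m<1+n r) (up∀ w) s
    up (Ω∀ r m h)     = Ω∀ (m<n⇒m<1+n r) m
                          (λ a w → up (h a (Wit∀-cong (Prev-step r) w)))
    up (Ω̃∀ ξ ρ r w s h) = Ω̃∀ ξ ρ (m<n⇒m<1+n r) (up∀ w) s
                          (λ a w → up (h a (Wit∀-cong (Prev-step r) w)))
    up (∃₂L r m w s)  = ∃₂L (m<n⇒m<1+n r) m (up∃ w) s
    up (Ω∃ r h)       = Ω∃ (m<n⇒m<1+n r)
                          (λ a w → up (h a (Wit∃-cong (Prev-step r) w)))
    up (Ω̃∃ ξ ρ r h w s) = Ω̃∃ ξ ρ (m<n⇒m<1+n r)
                          (λ a w → up (h a (Wit∃-cong (Prev-step r) w)))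
                          (up∃ w) s

    up∀ : ∀ {i B Γ} → Wit∀ (D i) B Γ → Wit∀ (D (suc i)) B Γ
    up∀ (wit π Z f d) = wit π Z f (up d)

    up∃ : ∀ {i B Γ Π} → Wit∃ (D i) B Γ Π → Wit∃ (D (suc i)) B Γ Π
    up∃ (wit π Z f d) = wit π Z f (up d)

  Prev⇒D : ∀ {i j Γ Π} → j < i → Prev i j Γ Π → D i Γ Π
  Prev⇒D {suc i} {j} j<1+i d with j ≟ i
  ... | yes refl = up d
  ... | no  j≢i  = up (Prev⇒D (≤∧≢⇒< (s≤s⁻¹ j<1+i) j≢i) d)

  mutual
    -- Apart from Ω̃, the rules have the subformula property up to instances, so the bound on the
    -- sequent passes to the premises and forces `rank ξ < i`. Only Ω̃ can have `rank ξ` equal to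
    -- `i`, and those instances are removed.
    collapse : ∀ {i Γ Π} → D (suc i) Γ Π → Ranked i (Γ ⇒ Π) → D i Γ Π
    collapse (weaken s d) (a , b) = weaken s (collapse d (All.anti-mono s a , b))
    collapse (id m) _ = id m
    collapse (⊥L m) _ = ⊥L m
    collapse (∧L₁ {φ = φ} {ψ} m d) (a , b) =
      ∧L₁ m (collapse d (rank-left φ ψ (All.lookup a m) ∷ a , b))
    collapse (∧L₂ {φ = φ} {ψ} m d) (a , b) =
      ∧L₂ m (collapse d (rank-right φ ψ (All.lookup a m) ∷ a , b))
    collapse (∧R {φ = φ} {ψ} d e) (a , MaybeAll.just b) =
      ∧R (collapse d (a , MaybeAll.just (rank-left φ ψ b)))
         (collapse e (a , MaybeAll.just (rank-right φ ψ b)))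
    collapse (∨L {φ = φ} {ψ} m d e) (a , b) =
      ∨L m (collapse d (rank-left φ ψ (All.lookup a m) ∷ a , b))
           (collapse e (rank-right φ ψ (All.lookup a m) ∷ a , b))
    collapse (∨R₁ {φ = φ} {ψ} d) (a , MaybeAll.just b) =
      ∨R₁ (collapse d (a , MaybeAll.just (rank-left φ ψ b)))
    collapse (∨R₂ {φ = φ} {ψ} d) (a , MaybeAll.just b) =
      ∨R₂ (collapse d (a , MaybeAll.just (rank-right φ ψ b)))
    collapse (⊃L {φ = φ} {ψ} m d e) (a , b) =
      ⊃L m (collapse d (a , MaybeAll.just (rank-left φ ψ (All.lookup a m))))
           (collapse e (rank-right φ ψ (All.lookup a m) ∷ a , b))
    collapse (⊃R {φ = φ} {ψ} d) (a , MaybeAll.just b) =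
      ⊃R (collapse d (rank-left φ ψ b ∷ a , MaybeAll.just (rank-right φ ψ b)))
    collapse (∀₁L {φ = φ} m t d) (a , b) =
      ∀₁L m t (collapse d (rank-inst φ t (All.lookup a m) ∷ a , b))
    collapse (∀₁R {φ = φ} d) (a , MaybeAll.just b) =
      ∀₁R (λ t → collapse (d t) (a , MaybeAll.just (rank-inst φ t b)))
    collapse (∃₁L {φ = φ} m d) (a , b) =
      ∃₁L m (λ t → collapse (d t) (rank-inst φ t (All.lookup a m) ∷ a , b))
    collapse (∃₁R {φ = φ} t d) (a , MaybeAll.just b) =
      ∃₁R t (collapse d (a , MaybeAll.just (rank-inst φ t b)))
    -- The bound `rank (∀₂ ξ) ≤ i` is by computation `rank ξ < i`, the side condition needed in
    -- `D i`.
    collapse (∀₂R {ξ = ξ} r w s) (a , MaybeAll.just b) =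
      ∀₂R b (collapse∀ ξ (<⇒≤ b) (All.anti-mono s a) w) s
    collapse (Ω∀ {ξ = ξ} r m h) (a , b) = Ω∀ r′ m λ c w →
      collapse (h c (Wit∀-cong (sym (Prev-step r′)) w))
               (All.++⁺ (raise (<⇒≤ r′) c) a , b)
      where r′ = All.lookup a m
    collapse (Ω̃∀ ξ ρ r w s h) (a , b) with m≤n⇒m<n∨m≡n (s≤s⁻¹ r)
    -- The collapsed witness is a derivation in `D i`, hence one of the indices of `h`. The premise
    -- at this index proves the conclusion, up to the copy of `Δ`, which lies in the antecedent
    -- already.
    ... | inj₂ refl =
      weaken (λ m → [ s , identity ] (∈-++⁻ _ m))
        (collapse (h a′ (Wit∀-cong (sym (Prev-top _))
                          (collapse∀ ξ ≤-refl a′ w)))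
                  (All.++⁺ a′ a , b))
      where a′ = All.anti-mono s a
    ... | inj₁ r′ =
      Ω̃∀ ξ ρ r′ (collapse∀ ξ (<⇒≤ r′) (All.anti-mono s a) w) s λ c w →
        collapse (h c (Wit∀-cong (sym (Prev-step r′)) w))
                 (All.++⁺ (raise (<⇒≤ r′) c) a , b)
    collapse (∃₂L {ξ = ξ} r m w s) (a , b) =
      ∃₂L r′ m (collapse∃ ξ (<⇒≤ r′) (All.anti-mono s a) b w) s
      where r′ = All.lookup a m
    collapse (Ω∃ {ξ = ξ} r h) (a , MaybeAll.just b) = Ω∃ b λ (c , c′) w →
      collapse (h (c , c′) (Wit∃-cong (sym (Prev-step b)) w))
               ( All.++⁺ (raise (<⇒≤ b) c) a
               , raiseᴳ (<⇒≤ b) c′)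
    collapse (Ω̃∃ ξ ρ r h w s) (a , b) with m≤n⇒m<n∨m≡n (s≤s⁻¹ r)
    ... | inj₂ refl =
      weaken (λ m → [ s , identity ] (∈-++⁻ _ m))
        (collapse (h (a′ , b) (Wit∃-cong (sym (Prev-top _))
                          (collapse∃ ξ ≤-refl a′ b w)))
                  (All.++⁺ a′ a , b))
      where a′ = All.anti-mono s a
    ... | inj₁ r′ =
      Ω̃∃ ξ ρ r′
        (λ (c , c′) w →
          collapse (h (c , c′) (Wit∃-cong (sym (Prev-step r′)) w))
                   ( All.++⁺ (raise (<⇒≤ r′) c) a
                   , raiseᴳ (<⇒≤ r′) c′))
        (collapse∃ ξ (<⇒≤ r′) (All.anti-mono s a) b w) s

    collapse∀ : ∀ {i m k Γ} {ρ : Var m → Term 0} (ξ : Form m k) → rank ξ ≤ i →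
                All (λ φ → rank φ ≤ i) Γ → Wit∀ (D (suc i)) (λ Z → opened ρ Z ξ) Γ →
                Wit∀ (D i) (λ Z → opened ρ Z ξ) Γ
    collapse∀ ξ r a (wit π Z f d) =
      wit π Z f (collapse d (ranked-renFree a , MaybeAll.just (rank-opened ξ Z r)))

    collapse∃ : ∀ {i m k Γ Π} {ρ : Var m → Term 0} (ξ : Form m k) → rank ξ ≤ i →
                All (λ φ → rank φ ≤ i) Γ → MaybeAll.All (λ φ → rank φ ≤ i) Π →
                Wit∃ (D (suc i)) (λ Z → opened ρ Z ξ) Γ Π → Wit∃ (D i) (λ Z → opened ρ Z ξ) Γ Π
    collapse∃ ξ r a b (wit {Π = Π} π Z f d) =
      wit π Z f (collapse d (rank-opened ξ Z r ∷ ranked-renFree a , ranked-renFreeᴳ Π b))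

  -- A sequent of rank 0 meets the bound at every level on the way down, so the collapses can be
  -- chained.
  collapse* : ∀ {Γ Π} i → D i Γ Π → Ranked 0 (Γ ⇒ Π) → D 0 Γ Π
  collapse* zero    d a       = d
  collapse* (suc i) d (a , b) =
    collapse* i (collapse d (raise z≤n a , raiseᴳ z≤n b)) (a , b)

  -- Fresh variables

  Bounded : (ℕ → Set) → Set
  Bounded P = ∃ λ N → ∀ x → P x → x < N

  bounded-⊎ : ∀ {P Q R : ℕ → Set} → Bounded P → Bounded Q → (∀ x → R x → P x ⊎ Q x) → Bounded R
  bounded-⊎ (M , p) (N , q) h = M ⊔ N , λ x r →
    [ (λ c → ≤-trans (p x c) (m≤m⊔n M N)) , (λ c → ≤-trans (q x c) (m≤n⊔m M N)) ] (h x r)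

  bounded-⊆ : ∀ {P Q : ℕ → Set} → Bounded P → (∀ x → Q x → P x) → Bounded Q
  bounded-⊆ (N , p) h = N , λ x → p x ∘ h x

  mutual
    bounded-∈ᵗ : ∀ {m} (t : Term m) → Bounded (λ x → free x ∈ᵗ t)
    bounded-∈ᵗ (var (free x))  = suc x , λ { _ var → ≤-refl }
    bounded-∈ᵗ (var (bound i)) = 0 , λ _ ()
    bounded-∈ᵗ (fun f ts)      = bounded-⊆ (bounded-∈ᵗˢ ts) λ { _ (fun p) → p }

    bounded-∈ᵗˢ : ∀ {m a} (ts : Vec (Term m) a) → Bounded (λ x → VecAny.Any (free x ∈ᵗ_) ts)
    bounded-∈ᵗˢ []       = 0 , λ _ ()
    bounded-∈ᵗˢ (t ∷ ts) = bounded-⊎ (bounded-∈ᵗ t) (bounded-∈ᵗˢ ts)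
      λ { _ (VecAny.here p) → inj₁ p ; _ (VecAny.there p) → inj₂ p }

  bounded-∈Fv : ∀ {m k} (φ : Form m k) → Bounded (λ x → free x ∈Fv φ)
  bounded-∈Fv (pred p ts)  = bounded-⊆ (bounded-∈ᵗˢ ts) λ { _ (pred p) → p }
  bounded-∈Fv (app X t)    = bounded-⊆ (bounded-∈ᵗ t) λ { _ (app p) → p }
  bounded-∈Fv ⊥            = 0 , λ _ ()
  bounded-∈Fv (conn c φ ψ) = bounded-⊎ (bounded-∈Fv φ) (bounded-∈Fv ψ)
    λ { _ (left p) → inj₁ p ; _ (right p) → inj₂ p }
  bounded-∈Fv (quan₁ q φ)  = bounded-⊆ (bounded-∈Fv φ) λ { _ (quan₁ p) → p }
  bounded-∈Fv (quan₂ q φ)  = bounded-⊆ (bounded-∈Fv φ) λ { _ (quan₂ p) → p }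

  bounded-∈FV : ∀ {m k} (φ : Form m k) → Bounded (λ X → free X ∈FV φ)
  bounded-∈FV (pred p ts)       = 0 , λ _ ()
  bounded-∈FV (app (free X) t)  = suc X , λ { _ app → ≤-refl }
  bounded-∈FV (app (bound i) t) = 0 , λ _ ()
  bounded-∈FV ⊥                 = 0 , λ _ ()
  bounded-∈FV (conn c φ ψ)      = bounded-⊎ (bounded-∈FV φ) (bounded-∈FV ψ)
    λ { _ (left p) → inj₁ p ; _ (right p) → inj₂ p }
  bounded-∈FV (quan₁ q φ)       = bounded-⊆ (bounded-∈FV φ) λ { _ (quan₁ p) → p }
  bounded-∈FV (quan₂ q φ)       = bounded-⊆ (bounded-∈FV φ) λ { _ (quan₂ p) → p }

  -- A bound and not just one fresh name: `aside` needs all variables from `N` on to be absent.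
  bounded-sequent : {P : ℕ → Formula → Set} → (∀ φ → Bounded (λ x → P x φ)) →
                    ∀ S → ∃ λ N → AllFormulas (λ φ → ∀ x → P x φ → x < N) S
  bounded-sequent b ([] ⇒ nothing) = 0 , [] , MaybeAll.nothing
  bounded-sequent b ([] ⇒ just φ) with N , p ← b φ = N , [] , MaybeAll.just p
  bounded-sequent b (φ ∷ Γ ⇒ Π) with M , p ← b φ | N , q , r ← bounded-sequent b (Γ ⇒ Π) =
    M ⊔ N ,
    (λ x c → ≤-trans (p x c) (m≤m⊔n M N)) ∷
      All.map (λ f x c → ≤-trans (f x c) (m≤n⊔m M N)) q ,
    MaybeAll.map (λ f x c → ≤-trans (f x c) (m≤n⊔m M N)) r

  exists-fresh : {P : ℕ → Formula → Set} → (∀ φ → Bounded (λ x → P x φ)) →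
                 ∀ S → ∃ λ N → AllFormulas (λ φ → ¬ P N φ) S
  exists-fresh b (Γ ⇒ Π) with N , p , q ← bounded-sequent b (Γ ⇒ Π) =
    N , All.map (λ f c → n≮n N (f N c)) p , MaybeAll.map (λ f c → n≮n N (f N c)) q

  -- From `D 0` to LI

  Fm-subst₁ : ∀ {m m′ k} {σ : Subst₁ m m′} {φ : Form m k} → Fm φ → Fm (subst₁ σ φ)
  Fm-subst₁ pred       = pred
  Fm-subst₁ app        = app
  Fm-subst₁ ⊥          = ⊥
  Fm-subst₁ (conn a b) = conn (Fm-subst₁ a) (Fm-subst₁ b)
  Fm-subst₁ (quan₁ a)  = quan₁ (Fm-subst₁ a)

  -- Rules of `Der` find the principal formula in the antecedent, while left rules of LI put it at
  -- the head; as sets the antecedents coincide.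
  absorb : ∀ {φ : Formula} {Γ Π} → φ ∈ Γ → (φ ∷ Γ ⇒ Π) ≈ (Γ ⇒ Π)
  absorb m = same (mk⇔ (λ { (here refl) → m ; (there p) → p }) there)

  unchanged : ∀ {Γ Π} → (Γ ⇒ Π) ≈ (Γ ⇒ Π)
  unchanged = same (mk⇔ identity identity)

  -- The larger antecedent `Δ` takes up `weaken`, which LI has no rule for. Rules for set
  -- quantifiers would need a rank below 0. Of the infinitely many premises of `∀₁R` and `∃₁L`, the
  -- one at a fresh variable is kept.
  toLI : ∀ {Γ Δ Π} → D 0 Γ Π → Γ ⊆ Δ → AllFormulas Fm (Δ ⇒ Π) → LI ⊢ᶜᶠ Δ ⇒ Π
  toLI (weaken s d) s′ a = toLI d (⊆-trans s s′) a
  toLI (id m) s a = infer a id (absorb (s m)) []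
  toLI (⊥L m) s a = infer a ⊥L (absorb (s m)) []
  toLI (∧L₁ m d) s (a , b) with conn p _ ← All.lookup a (s m) =
    infer (a , b) ∧L₁ (absorb (s m)) (toLI d (∷⁺ʳ _ s) (p ∷ a , b) ∷ [])
  toLI (∧L₂ m d) s (a , b) with conn _ q ← All.lookup a (s m) =
    infer (a , b) ∧L₂ (absorb (s m)) (toLI d (∷⁺ʳ _ s) (q ∷ a , b) ∷ [])
  toLI (∧R d e) s (a , MaybeAll.just (conn p q)) =
    infer (a , MaybeAll.just (conn p q)) ∧R unchanged
      (toLI d s (a , MaybeAll.just p) ∷ toLI e s (a , MaybeAll.just q) ∷ [])
  toLI (∨L m d e) s (a , b) with conn p q ← All.lookup a (s m) =
    infer (a , b) ∨L (absorb (s m))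
      (toLI d (∷⁺ʳ _ s) (p ∷ a , b) ∷ toLI e (∷⁺ʳ _ s) (q ∷ a , b) ∷ [])
  toLI (∨R₁ d) s (a , MaybeAll.just (conn p q)) =
    infer (a , MaybeAll.just (conn p q)) ∨R₁ unchanged (toLI d s (a , MaybeAll.just p) ∷ [])
  toLI (∨R₂ d) s (a , MaybeAll.just (conn p q)) =
    infer (a , MaybeAll.just (conn p q)) ∨R₂ unchanged (toLI d s (a , MaybeAll.just q) ∷ [])
  toLI (⊃L m d e) s (a , b) with conn p q ← All.lookup a (s m) =
    infer (a , b) ⊃L (absorb (s m))
      (toLI d s (a , MaybeAll.just p) ∷ toLI e (∷⁺ʳ _ s) (q ∷ a , b) ∷ [])
  toLI (⊃R d) s (a , MaybeAll.just (conn p q)) =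
    infer (a , MaybeAll.just (conn p q)) ⊃R unchanged
      (toLI d (∷⁺ʳ _ s) (p ∷ a , MaybeAll.just q) ∷ [])
  toLI (∀₁L m t d) s (a , b) with quan₁ p ← All.lookup a (s m) =
    infer (a , b) (∀₁L t) (absorb (s m)) (toLI d (∷⁺ʳ _ s) (Fm-subst₁ p ∷ a , b) ∷ [])
  toLI {Δ = Δ} (∀₁R {φ = φ} d) s (a , MaybeAll.just (quan₁ p))
    with y , f ← exists-fresh bounded-∈Fv (Δ ⇒ just (∀₁ φ)) =
    infer (a , MaybeAll.just (quan₁ p)) (∀₁R y f) unchanged
      (toLI (d (var (free y))) s (a , MaybeAll.just (Fm-subst₁ p)) ∷ [])
  toLI {Δ = Δ} {Π} (∃₁L {φ = φ} m d) s (a , b)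
    with quan₁ p ← All.lookup a (s m) | y , f ← exists-fresh bounded-∈Fv (∃₁ φ ∷ Δ ⇒ Π) =
    infer (a , b) (∃₁L y f) (absorb (s m))
      (toLI (d (var (free y))) (∷⁺ʳ _ s) (Fm-subst₁ p ∷ a , b) ∷ [])
  toLI (∃₁R t d) s (a , MaybeAll.just (quan₁ p)) =
    infer (a , MaybeAll.just (quan₁ p)) (∃₁R t) unchanged
      (toLI d s (a , MaybeAll.just (Fm-subst₁ p)) ∷ [])

  -- Renaming indices of Ω-rules

  map-renFree-id : ∀ Γ → map (renFree identity) Γ ≡ Γ
  map-renFree-id Γ = trans (map-cong (λ φ → sub-id φ (λ _ → refl) (λ _ → refl)) Γ) (map-id Γ)

  map-renFree-idᴳ : ∀ Π → Maybe.map (renFree identity) Π ≡ Π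
  map-renFree-idᴳ (just φ) = cong just (sub-id φ (λ _ → refl) (λ _ → refl))
  map-renFree-idᴳ nothing  = refl

  FMP-quan₂ : ∀ {i m k q} {ξ : Form m (suc k)} → FMP i (quan₂ q ξ) →
              rank ξ < i × ParameterFree ξ × ∃ λ j → FMP j ξ
  FMP-quan₂ (quan₂ a pf) = s≤s (FMP⇒rank≤ a) , pf , _ , a

  rename-ranked : ∀ {j π} {Γ : Ctx} → All (λ φ → rank φ ≤ j) Γ →
                  All (λ φ → rank φ ≤ j) (map (renFree π) Γ)
  rename-ranked = All.map⁺ ∘ All.map (λ {φ} → subst (_≤ _) (sym (rank-sub φ)))

  rename-rankedᴳ : ∀ {j π} (Π : Goal) → MaybeAll.All (λ φ → rank φ ≤ j) Π →
                   MaybeAll.All (λ φ → rank φ ≤ j) (Maybe.map (renFree π) Π)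
  rename-rankedᴳ (just φ) (MaybeAll.just r) = MaybeAll.just (subst (_≤ _) (sym (rank-sub φ)) r)
  rename-rankedᴳ nothing  _                 = MaybeAll.nothing

  renFree-∘ : ∀ σ π φ → renFree σ (renFree π φ) ≡ renFree (σ ∘ π) φ
  renFree-∘ σ π φ = sub-∘ φ (λ _ _ → refl) (λ _ _ → refl)

  map-renFree-∘ : ∀ σ π Γ → map (renFree (σ ∘ π)) Γ ≡ map (renFree σ) (map (renFree π) Γ)
  map-renFree-∘ σ π Γ = trans (map-cong (λ φ → sym (renFree-∘ σ π φ)) Γ) (map-∘ Γ)

  map-renFree-∘ᴳ : ∀ σ π Π →
                   Maybe.map (renFree (σ ∘ π)) Π ≡ Maybe.map (renFree σ) (Maybe.map (renFree π) Π)
  map-renFree-∘ᴳ σ π (just φ) = cong just (sym (renFree-∘ σ π φ))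
  map-renFree-∘ᴳ σ π nothing  = refl

  -- The renaming is composed with the stored one; the derivation inside remains untouched.
  Wit∀-rename : ∀ {R B Γ} σ → Wit∀ R B Γ → Wit∀ R B (map (renFree σ) Γ)
  Wit∀-rename {R} {B} σ (wit {Γ} π Z f d) =
    subst (Wit∀ R B) (map-renFree-∘ σ π Γ) (wit (σ ∘ π) Z f d)

  Wit∃-rename : ∀ {R B Γ Π} σ → Wit∃ R B Γ Π →
                Wit∃ R B (map (renFree σ) Γ) (Maybe.map (renFree σ) Π)
  Wit∃-rename {R} {B} σ (wit {Γ} {Π} π Z f d) =
    subst₂≡ (Wit∃ R B) (map-renFree-∘ σ π Γ) (map-renFree-∘ᴳ σ π Π) (wit (σ ∘ π) Z f d)

  all-goal : ∀ {ℓ} {P : Formula → Set ℓ} Π → (∀ φ → P φ) → MaybeAll.All P Π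
  all-goal (just φ) p = MaybeAll.just (p φ)
  all-goal nothing  p = MaybeAll.nothing

  -- Closed sets of antecedents

  module Semantics (i : ℕ) where

    infix 4 _∋_ _≃_

    -- On upward closed sets, this is the MacNeille closure: Γ belongs to Cl A if every
    -- goal that is derivable from all extensions of Δ in A is derivable from Δ, for
    -- all Δ ⊇ Γ.
    Cl : (Ctx → Set) → Ctx → Set
    Cl A Γ = ∀ {Δ} Π → Γ ⊆ Δ → (∀ {Θ} → Δ ⊆ Θ → A Θ → D i Θ Π) → D i Δ Π

    record Val : Set₁ where
      no-eta-equality
      field
        carrier : Ctx → Set
        mono    : ∀ {Γ Δ} → Γ ⊆ Δ → carrier Γ → carrier Δ
        run     : ∀ {Γ} → Cl carrier Γ → carrier Γ
    open Val

    _∋_ : Val → Ctx → Set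
    A ∋ Γ = carrier A Γ

    -- `Cl` acts as a monad with the closed sets as algebras. Disjunctions, existentials and
    -- universal set quantifiers are eliminated in this way into the value of an arbitrary goal.
    bind : ∀ {A Γ} (B : Val) → Cl A Γ → (∀ {Δ} → Γ ⊆ Δ → A Δ → B ∋ Δ) → B ∋ Γ
    bind B c k = run B λ Π s h → c Π s λ s′ a → h s′ (k (⊆-trans s s′) a)

    closure : (Ctx → Set) → Val
    closure A = record
      { carrier = Cl A
      ; mono    = λ s c Π s′ → c Π (⊆-trans s s′)
      ; run     = λ c Π s k → c Π s λ s′ c′ → c′ Π ⊆-refl λ s″ → k (⊆-trans s′ s″)
      }

    derives : Formula → Val
    derives φ = record
      { carrier = λ Γ → D i Γ (just φ)
      ; mono    = weaken
      ; run     = λ c → c (just φ) ⊆-refl λ _ d → d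
      }

    connV : Connective → Val → Val → Val
    connV conj A B = record
      { carrier = λ Γ → A ∋ Γ × B ∋ Γ
      ; mono    = λ s (a , b) → mono A s a , mono B s b
      ; run     = λ c → run A (λ Π s k → c Π s λ s′ (a , _) → k s′ a)
                      , run B (λ Π s k → c Π s λ s′ (_ , b) → k s′ b)
      }
    connV disj A B = closure λ Γ → A ∋ Γ ⊎ B ∋ Γ
    connV impl A B = record
      { carrier = λ Γ → ∀ {Δ} → Γ ⊆ Δ → A ∋ Δ → B ∋ Δ
      ; mono    = λ s f s′ → f (⊆-trans s s′)
      ; run     = λ c s a → bind B (λ Π s′ → c Π (⊆-trans s s′)) λ s′ f → f ⊆-refl (mono A s′ a)
      }

    quanV : Quantifier → (Term 0 → Val) → Val
    quanV univ F = record
      { carrier = λ Γ → ∀ t → F t ∋ Γ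
      ; mono    = λ s f t → mono (F t) s (f t)
      ; run     = λ c t → run (F t) λ Π s k → c Π s λ s′ f → k s′ (f t)
      }
    quanV exis F = closure λ Γ → ∃ λ t → F t ∋ Γ

    -- The universal value is generated by the antecedents that contain an index of `Ω∀`; the
    -- existential one asks for what the premises of `Ω∃` provide. Both range over sequents and not
    -- over `Val`, so the carriers stay small.
    omegaV : Quantifier → ℕ → (ℕ → Formula) → Val
    omegaV univ j B = closure λ Γ →
      ∃ λ Δ → Δ ⊆ Γ × All (λ φ → rank φ ≤ j) Δ × Wit∀ (Prev i j) B Δ
    omegaV exis j B = record
      { carrier = λ Γ → ∀ {Σ Π} → Ranked j (Σ ⇒ Π) → Wit∃ (Prev i j) B Σ Π →
                  ∀ {Δ} → Γ ⊆ Δ → Σ ⊆ Δ → D i Δ Π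
      ; mono    = λ s f r w s′ → f r w (⊆-trans s s′)
      ; run     = λ c {Σ} {Π} r w s s′ → c Π s λ s″ f → f r w ⊆-refl (⊆-trans s′ s″)
      }

    record _≃_ (A B : Val) : Set where
      constructor _,_
      field
        to   : ∀ {Γ} → A ∋ Γ → B ∋ Γ
        from : ∀ {Γ} → B ∋ Γ → A ∋ Γ
    open _≃_

    ≃-refl : ∀ {A} → A ≃ A
    ≃-refl = (λ a → a) , (λ a → a)

    ≃-sym : ∀ {A B} → A ≃ B → B ≃ A
    ≃-sym (f , g) = g , f

    ≃-trans : ∀ {A B C} → A ≃ B → B ≃ C → A ≃ C
    ≃-trans (f , g) (f′ , g′) = (λ a → f′ (f a)) , (λ c → g (g′ c))

    ≡⇒≃ : ∀ {A B} → A ≡ B → A ≃ B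
    ≡⇒≃ refl = ≃-refl

    connV-to : ∀ c {A A′ B B′} → A ≃ A′ → B ≃ B′ → ∀ {Γ} → connV c A B ∋ Γ → connV c A′ B′ ∋ Γ
    connV-to conj (f , _) (g , _) (a , b) = f a , g b
    connV-to disj (f , _) (g , _) c Π s k = c Π s λ s′ → k s′ ∘ [ inj₁ ∘ f , inj₂ ∘ g ]
    connV-to impl (_ , f) (g , _) h s a   = g (h s (f a))

    connV-cong : ∀ c {A A′ B B′} → A ≃ A′ → B ≃ B′ → connV c A B ≃ connV c A′ B′
    connV-cong c e e′ = connV-to c e e′ , connV-to c (≃-sym e) (≃-sym e′)

    quanV-to : ∀ q {F G} → (∀ t → F t ≃ G t) → ∀ {Γ} → quanV q F ∋ Γ → quanV q G ∋ Γ
    quanV-to univ e f t     = to (e t) (f t)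
    quanV-to exis e c Π s k = c Π s λ s′ (t , a) → k s′ (t , to (e t) a)

    quanV-cong : ∀ q {F G} → (∀ t → F t ≃ G t) → quanV q F ≃ quanV q G
    quanV-cong q e = quanV-to q e , quanV-to q (λ t → ≃-sym (e t))

    omegaV-to : ∀ q {j B B′} → B ≗ B′ → ∀ {Γ} → omegaV q j B ∋ Γ → omegaV q j B′ ∋ Γ
    omegaV-to univ e c Π s k =
      c Π s λ s′ (Δ , s″ , r , w) → k s′ (Δ , s″ , r , Wit∀-≗ e w)
    omegaV-to exis e f r w = f r (Wit∃-≗ (sym ∘ e) w)

    omegaV-cong : ∀ q {j j′ B B′} → j ≡ j′ → B ≗ B′ → omegaV q j B ≃ omegaV q j′ B′
    omegaV-cong q refl e = omegaV-to q e , omegaV-to q (sym ∘ e)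

    -- Interpretation of formulas and substitution lemmas

    Pred : Set₁
    Pred = Term 0 → Val

    -- The clause for quan₂ is meant for parameter-free formulas: V is irrelevant there.
    ⟦_⟧ : ∀ {m k} → Form m k → (Var m → Term 0) → (Var k → Pred) → Val
    ⟦ pred p ts ⟧  ρ V = derives (pred p (subTerms ρ ts))
    ⟦ app X t ⟧    ρ V = V X (subTerm ρ t)
    ⟦ ⊥ ⟧          ρ V = closure λ _ → Empty
    ⟦ conn c φ ψ ⟧ ρ V = connV c (⟦ φ ⟧ ρ V) (⟦ ψ ⟧ ρ V)
    ⟦ quan₁ q φ ⟧  ρ V = quanV q λ t → ⟦ φ ⟧ (ρ ▹ t) V
    ⟦ quan₂ q φ ⟧  ρ V = omegaV q (rank φ) λ Z → opened ρ Z φ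

    -- No restriction to parameter-free formulas is made: the clause for `quan₂` sees only the
    -- opened body, on which `θ` has no effect.
    sub-sem : ∀ {m m′ k k′} {σ : Var m → Term m′} {θ : Var k → Var k′} {ρ ρ′ V V′} φ →
              (∀ x → x ∈Fv φ → subTerm ρ′ (σ x) ≡ ρ x) →
              (∀ X → X ∈FV φ → ∀ t → V′ (θ X) t ≃ V X t) →
              ⟦ sub σ θ φ ⟧ ρ′ V′ ≃ ⟦ φ ⟧ ρ V
    sub-sem (pred p ts) h H = ≡⇒≃ (cong (derives ∘ pred p) (subTerms-∘ ts λ x → h x ∘ pred))
    sub-sem {V′ = V′} (app X t) h H =
      ≃-trans (≡⇒≃ (cong (V′ _) (subTerm-∘ t λ x → h x ∘ app))) (H X app _)
    sub-sem ⊥ h H = ≃-refl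
    sub-sem (conn c φ ψ) h H =
      connV-cong c (sub-sem φ (λ x → h x ∘ left) (λ X → H X ∘ left))
                   (sub-sem ψ (λ x → h x ∘ right) (λ X → H X ∘ right))
    sub-sem {σ = σ} {ρ = ρ} {ρ′} (quan₁ q φ) h H =
      quanV-cong q λ t → sub-sem φ (λ x → lift t (view x)) (λ X → H X ∘ quan₁)
      where
      lift : ∀ t {x} → View x → x ∈Fv φ → subTerm (ρ′ ▹ t) (liftTerm σ x) ≡ (ρ ▹ t) x
      lift t top    _ = refl
      lift t (wk x) p =
        trans (cong (subTerm _) (▹-wk _ _ x))
          (trans (subTerm-∘ (σ x) (λ y _ → ▹-wk _ _ y))
            (trans (h x (quan₁ p)) (sym (▹-wk _ _ x))))
    sub-sem (quan₂ q φ) h H =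
      omegaV-cong q (rank-sub φ) λ _ → opened-sub φ (λ x → h x ∘ quan₂)

    coincidence : ∀ {m k} {ρ ρ′ V V′} (φ : Form m k) →
                  (∀ x → x ∈Fv φ → ρ′ x ≡ ρ x) →
                  (∀ X → X ∈FV φ → ∀ t → V′ X t ≃ V X t) →
                  ⟦ φ ⟧ ρ′ V′ ≃ ⟦ φ ⟧ ρ V
    coincidence {ρ′ = ρ′} {V′ = V′} φ h H =
      ≃-trans (≡⇒≃ (cong (λ ψ → ⟦ ψ ⟧ ρ′ V′) (sym (sub-id φ (λ _ → refl) (λ _ → refl)))))
              (sub-sem φ h H)

    subst₁-sem : ∀ {m m′ k} {σ : Subst₁ m m′} {ρ ρ′} {V V′ : Var k → Pred} φ →
                 (∀ x → x ∈Fv φ → subTerm ρ′ (fullSubst σ x) ≡ ρ x) →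
                 (∀ X → X ∈FV φ → ∀ t → V′ X t ≃ V X t) →
                 ⟦ subst₁ σ φ ⟧ ρ′ V′ ≃ ⟦ φ ⟧ ρ V
    subst₁-sem {ρ′ = ρ′} {V′ = V′} φ h H =
      ≃-trans (≡⇒≃ (cong (λ ψ → ⟦ ψ ⟧ ρ′ V′) (subst₁≡sub _ φ))) (sub-sem φ h H)

    inst-sem : ∀ {m k} {ρ V} (φ : Form (suc m) k) t →
               ⟦ φ [ t ]₁ ⟧ ρ V ≃ ⟦ φ ⟧ (ρ ▹ subTerm ρ t) V
    inst-sem {ρ = ρ} φ t = subst₁-sem φ (λ x _ → at x) (λ _ _ _ → ≃-refl)
      where
      at : ∀ x → subTerm ρ (fullSubst (single₁ t) x) ≡ (ρ ▹ subTerm ρ t) x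
      at (free x)        = refl
      at (bound zero)    = refl
      at (bound (suc i)) = refl

    substEnv : ∀ {m k k′} → Subst₂ m k k′ → (Var m → Term 0) → (Var k′ → Pred) → Var k → Pred
    substEnv σ ρ V (free X)    = V (free X)
    substEnv σ ρ V (bound i) t = ⟦ σ i ⟧ (ρ ▹ t) V

    -- `FMP n φ` enters at `quan₂`: by parameter-freeness `σ` does not reach the body, and both
    -- sides have the same openings.
    subst₂-sem : ∀ {n m k k′} {σ : Subst₂ m k k′} {ρ V V′} {φ : Form m k} → FMP n φ →
                 (∀ X → X ∈FV φ → ∀ t → substEnv σ ρ V′ X t ≃ V X t) →
                 ⟦ subst₂ σ φ ⟧ ρ V′ ≃ ⟦ φ ⟧ ρ V
    subst₂-sem pred H = ≃-refl
    subst₂-sem (app {X = free X}) H = H _ app _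
    subst₂-sem {σ = σ} (app {X = bound i} {t}) H = ≃-trans (inst-sem (σ i) t) (H _ app _)
    subst₂-sem ⊥ H = ≃-refl
    subst₂-sem (conn a b) H =
      connV-cong _ (subst₂-sem a λ X → H X ∘ left) (subst₂-sem b λ X → H X ∘ right)
    subst₂-sem {σ = σ} {ρ} {V} {V′} {quan₁ q φ} (quan₁ a) H =
      quanV-cong q λ u → subst₂-sem a (lift u)
      where
      at : ∀ u t x → subTerm (ρ ▹ u ▹ t) (fullSubst (lift₁ shift₁) x) ≡ (ρ ▹ t) x
      at u t (free x)        = refl
      at u t (bound zero)    = refl
      at u t (bound (suc i)) = refl
      lift : ∀ u X → X ∈FV φ → ∀ t → substEnv (under₁ σ) (ρ ▹ u) V′ X t ≃ V X t
      lift u (free X)  p t = H _ (quan₁ p) t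
      lift u (bound i) p t =
        ≃-trans (subst₁-sem (σ i) (λ x _ → at u t x) (λ _ _ _ → ≃-refl)) (H _ (quan₁ p) t)
    subst₂-sem {σ = σ} {ρ} {V′ = V′} {quan₂ q ξ} (quan₂ a pf) H =
      ≃-trans (≡⇒≃ (cong (λ ψ → ⟦ quan₂ q ψ ⟧ ρ V′) (subst₂-parameterFree {σ = σ} pf)))
        (omegaV-cong q (rank-sub ξ) λ _ → opened-sub ξ λ _ _ → refl)

    -- Reflection and reification

    canonical : Var 0 → Pred
    canonical X t = derives (app X t)

    inst-sub : ∀ {m k k′} {ρ : Var m → Term 0} {θ : Var k → Var k′} (φ : Form (suc m) k) t →
               sub (liftTerm ρ) θ φ [ t ]₁ ≡ sub (ρ ▹ t) θ φ
    inst-sub {ρ = ρ} φ t =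
      trans (subst₁≡sub _ (sub (liftTerm ρ) _ φ)) (sub-∘ φ (λ x _ → at (view x)) (λ _ _ → refl))
      where
      fix : ∀ {m} {t : Term m} y → fullSubst (single₁ t) (wkVar y) ≡ var y
      fix (free x)  = refl
      fix (bound i) = refl
      at : ∀ {x} → View x → subTerm (fullSubst (single₁ t)) (liftTerm ρ x) ≡ (ρ ▹ t) x
      at top    = refl
      at (wk x) =
        trans (cong (subTerm _) (▹-wk _ _ x))
          (trans (subTerm-∘ (ρ x) (λ y _ → fix y))
            (trans (subTerm-id (ρ x) (λ _ → refl)) (sym (▹-wk _ _ x))))

    Wit∀-embed : ∀ {j B Γ} → j < i → Wit∀ (Prev i j) B Γ → Wit∀ (D i) B Γ
    Wit∀-embed r (wit π Z f d) = wit π Z f (Prev⇒D r d)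

    Wit∃-embed : ∀ {j B Γ Π} → j < i → Wit∃ (Prev i j) B Γ Π → Wit∃ (D i) B Γ Π
    Wit∃-embed r (wit π Z f d) = wit π Z f (Prev⇒D r d)

    -- `Ω∀` allows any index to be added to the antecedent, which then belongs to the generating
    -- set. `j` and `B` are kept apart from `ξ`: in use `ξ` is a substituted body, whose rank and
    -- openings equal the original ones only up to proof.
    omega-reflect : ∀ q {j B Γ} {ξ : Form 0 1} → rank ξ ≡ j → (λ Z → opened var Z ξ) ≗ B → j < i →
                    quan₂ q ξ ∈ Γ → omegaV q j B ∋ Γ
    omega-reflect univ refl e r m Π s k = Ω∀ r (s m) λ a w →
      k (xs⊆ys++xs _ _) (_ , xs⊆xs++ys _ _ , a , Wit∀-≗ e w)
    omega-reflect exis refl e r m _ w s = ∃₂L r (s m) (Wit∃-≗ (sym ∘ e) (Wit∃-embed r w))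

    omega-reify : ∀ q {j B Γ} {ξ : Form 0 1} → rank ξ ≡ j → (λ Z → opened var Z ξ) ≗ B → j < i →
                  omegaV q j B ∋ Γ → D i Γ (just (quan₂ q ξ))
    omega-reify univ refl e r c = c _ ⊆-refl λ _ (_ , s , _ , w) →
      ∀₂R r (Wit∀-≗ (sym ∘ e) (Wit∀-embed r w)) s
    omega-reify exis refl e r c = Ω∃ r λ a w →
      c a (Wit∃-≗ e w) (xs⊆ys++xs _ _) (xs⊆xs++ys _ _)

    mutual
      -- Mutual with `reify` because of implication. A set quantifier is not entered: its value is
      -- already stated in terms of derivability.
      reflect : ∀ {m k} (φ : Form m k) {ρ θ Γ} → rank φ ≤ i → sub ρ θ φ ∈ Γ →
                ⟦ φ ⟧ ρ (canonical ∘ θ) ∋ Γ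
      reflect (pred p ts) r m = id m
      reflect (app X t)   r m = id m
      reflect ⊥           r m = λ Π s k → ⊥L (s m)
      reflect (φ ∧ ψ) {ρ} {θ} r m =
        run (⟦ φ ⟧ ρ (canonical ∘ θ))
          (λ Π s k → ∧L₁ (s m) (k there (reflect φ (m⊔n≤o⇒m≤o _ _ r) (here refl)))) ,
        run (⟦ ψ ⟧ ρ (canonical ∘ θ))
          (λ Π s k → ∧L₂ (s m) (k there (reflect ψ (m⊔n≤o⇒n≤o _ _ r) (here refl))))
      reflect (φ ∨ ψ) r m = λ Π s k → ∨L (s m)
        (k there (inj₁ (reflect φ (m⊔n≤o⇒m≤o _ _ r) (here refl))))
        (k there (inj₂ (reflect ψ (m⊔n≤o⇒n≤o _ _ r) (here refl))))
      reflect (φ ⊃ ψ) {ρ} {θ} r m s a = run (⟦ ψ ⟧ ρ (canonical ∘ θ)) λ Π s′ k →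
        ⊃L (s′ (s m)) (reify φ (m⊔n≤o⇒m≤o _ _ r) (mono (⟦ φ ⟧ ρ (canonical ∘ θ)) s′ a))
          (k there (reflect ψ (m⊔n≤o⇒n≤o _ _ r) (here refl)))
      reflect (∀₁ φ) {ρ} {θ} r m t = run (⟦ φ ⟧ (ρ ▹ t) (canonical ∘ θ)) λ Π s k →
        ∀₁L (s m) t (k there (reflect φ r (here (sym (inst-sub φ t)))))
      reflect (∃₁ φ) r m Π s k = ∃₁L (s m) λ t →
        k there (t , reflect φ r (here (sym (inst-sub φ t))))
      reflect (quan₂ q ξ) r m =
        omega-reflect q (rank-sub ξ) (λ _ → opened-sub ξ λ x _ → subTerm-id _ λ _ → refl) r m

      reify : ∀ {m k} (φ : Form m k) {ρ θ Γ} → rank φ ≤ i → ⟦ φ ⟧ ρ (canonical ∘ θ) ∋ Γ →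
              D i Γ (just (sub ρ θ φ))
      reify (pred p ts) r d = d
      reify (app X t)   r d = d
      reify ⊥           r c = c _ ⊆-refl λ _ ()
      reify (φ ∧ ψ) r (a , b) =
        ∧R (reify φ (m⊔n≤o⇒m≤o _ _ r) a) (reify ψ (m⊔n≤o⇒n≤o _ _ r) b)
      reify (φ ∨ ψ) r c = c _ ⊆-refl λ _ →
        [ ∨R₁ ∘ reify φ (m⊔n≤o⇒m≤o _ _ r) , ∨R₂ ∘ reify ψ (m⊔n≤o⇒n≤o _ _ r) ]
      reify (φ ⊃ ψ) r f =
        ⊃R (reify ψ (m⊔n≤o⇒n≤o _ _ r) (f there (reflect φ (m⊔n≤o⇒m≤o _ _ r) (here refl))))
      reify (∀₁ φ) r f = ∀₁R λ t →
        subst (D i _ ∘ just) (sym (inst-sub φ t)) (reify φ r (f t))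
      reify (∃₁ φ) r c = c _ ⊆-refl λ _ (t , a) →
        ∃₁R t (subst (D i _ ∘ just) (sym (inst-sub φ t)) (reify φ r a))
      reify (quan₂ q ξ) r c =
        omega-reify q (rank-sub ξ) (λ _ → opened-sub ξ λ x _ → subTerm-id _ λ _ → refl) r c

    -- Soundness of the infinitary calculus

    ⟦_⟧ᴳ : Goal → (Var 0 → Term 0) → (Var 0 → Pred) → Val
    ⟦ just φ ⟧ᴳ  = ⟦ φ ⟧
    ⟦ nothing ⟧ᴳ = ⟦ ⊥ ⟧

    Forces : (Var 0 → Term 0) → (Var 0 → Pred) → Ctx → Ctx → Set
    Forces ρ V Γ Θ = All (λ φ → ⟦ φ ⟧ ρ V ∋ Θ) Γ

    Forces-mono : ∀ {ρ V Γ Θ Δ} → Θ ⊆ Δ → Forces ρ V Γ Θ → Forces ρ V Γ Δ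
    Forces-mono {ρ} {V} s = All.map λ {φ} → mono (⟦ φ ⟧ ρ V) s

    reflect-ctx : ∀ {Γ Δ} → All (λ φ → rank φ ≤ i) Γ → Γ ⊆ Δ → Forces var canonical Γ Δ
    reflect-ctx {Γ} {Δ} a s = All.tabulate λ {φ} m → reflect φ (All.lookup a m)
      (subst (_∈ Δ) (sym (sub-id φ (λ _ → refl) (λ _ → refl))) (s m))

    reify-goal : ∀ {Γ} Π → MaybeAll.All (λ φ → rank φ ≤ i) Π → ⟦ Π ⟧ᴳ var canonical ∋ Γ → D i Γ Π
    reify-goal nothing  _                c = c nothing ⊆-refl λ _ ()
    reify-goal (just φ) (MaybeAll.just r) a =
      subst (D i _ ∘ just) (sub-id φ (λ _ → refl) (λ _ → refl)) (reify φ r a)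

    -- Taking `C` canonical at a fresh `Z` and reifying gives ξ(Z) in `D i`. This is not yet an
    -- index, which would have to be derived in the calculus of level `rank ξ`; `Ω̃∀` bridges the
    -- gap, to be resolved by `collapse`.
    ∀₂-intro : ∀ {m k Γ ρ} (ξ : Form m (suc k)) → rank ξ < i → (∀ C → ⟦ ξ ⟧ ρ (λ _ → C) ∋ Γ) →
               omegaV univ (rank ξ) (λ Z → opened ρ Z ξ) ∋ Γ
    ∀₂-intro {ρ = ρ} ξ r h {Δ} Π s k with Z , f , _ ← exists-fresh bounded-∈FV (Δ ⇒ nothing) =
      Ω̃∀ ξ ρ r
        (wit identity Z f (reify ξ (<⇒≤ r) (mono (⟦ ξ ⟧ ρ (λ _ → C Z)) s (h (C Z)))))
        (⊆-reflexive (map-renFree-id Δ))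
        λ a w → k (xs⊆ys++xs _ _) (_ , xs⊆xs++ys _ _ , a , w)
      where
      C : ℕ → Pred
      C Z = canonical (free Z)

    -- Dual to `∀₂-intro`. The goal `Π` that `run` supplies turns membership in `B` into a
    -- derivation from ξ(Z), the second premise of `Ω̃∃`.
    ∃₂-elim : ∀ {m k Γ ρ} (ξ : Form m (suc k)) (B : Val) → rank ξ < i →
              omegaV exis (rank ξ) (λ Z → opened ρ Z ξ) ∋ Γ →
              (∀ C {Δ} → Γ ⊆ Δ → ⟦ ξ ⟧ ρ (λ _ → C) ∋ Δ → B ∋ Δ) → B ∋ Γ
    ∃₂-elim {ρ = ρ} ξ B r e h = run B λ {Δ} Π s k →
      eliminate Π s k (exists-fresh bounded-∈FV (Δ ⇒ Π))
      where
      eliminate : ∀ {Δ} Π → _ ⊆ Δ → (∀ {Θ} → Δ ⊆ Θ → B ∋ Θ → D i Θ Π) →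
                  (∃ λ Z → Fresh₂ Z (Δ ⇒ Π)) → D i Δ Π
      eliminate {Δ} Π s k (Z , f) =
        Ω̃∃ ξ ρ r (λ a w → e a w (⊆-trans s (xs⊆ys++xs _ _)) (xs⊆xs++ys _ _))
          (subst (Wit∃ (D i) _ _) (map-renFree-idᴳ Π)
            (wit identity Z f
              (k there (h (canonical (free Z)) (⊆-trans s there) (reflect ξ (<⇒≤ r) (here refl))))))
          (⊆-reflexive (map-renFree-id Δ))

    opened-sem : ∀ {m k ρ V Z C} (ξ : Form m k) → V (free Z) ≡ C →
                 ⟦ opened ρ Z ξ ⟧ var V ≃ ⟦ ξ ⟧ ρ (λ _ → C)
    opened-sem ξ e = sub-sem ξ (λ x _ → subTerm-id _ λ _ → refl)
                               (λ _ _ t → ≡⇒≃ (cong (λ F → F t) e))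

    Agree : (V V′ : Var 0 → Pred) → Formula → Set₁
    Agree V V′ φ = ∀ X → X ∈FV φ → V X ≡ V′ X

    renFree-sem : ∀ {π V V′} φ → Agree (V′ ∘ π) V φ → ⟦ renFree π φ ⟧ var V′ ≃ ⟦ φ ⟧ var V
    renFree-sem φ g = sub-sem φ (λ _ _ → refl) (λ X p t → ≡⇒≃ (cong (λ F → F t) (g X p)))

    rename-ctx : ∀ {π V V′ Γ Θ} → All (Agree (V′ ∘ π) V) Γ →
                 Forces var V Γ Θ → Forces var V′ (map (renFree π) Γ) Θ
    rename-ctx []               []      = []
    rename-ctx (_∷_ {x = φ} g gs) (a ∷ as) = from (renFree-sem φ g) a ∷ rename-ctx gs as

    unrename-ctx : ∀ {π V V′ Γ Θ} → All (Agree (V′ ∘ π) V) Γ →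
                   Forces var V′ (map (renFree π) Γ) Θ → Forces var V Γ Θ
    unrename-ctx []               []      = []
    unrename-ctx (_∷_ {x = φ} g gs) (a ∷ as) = to (renFree-sem φ g) a ∷ unrename-ctx gs as

    rename-goal : ∀ {π V V′ Π} → MaybeAll.All (Agree (V′ ∘ π) V) Π →
                  ⟦ Maybe.map (renFree π) Π ⟧ᴳ var V′ ≃ ⟦ Π ⟧ᴳ var V
    rename-goal {Π = just φ} (MaybeAll.just g) = renFree-sem φ g
    rename-goal MaybeAll.nothing = ≃-refl

    coincide : ∀ {ρ V V′} φ → Agree V′ V φ → ⟦ φ ⟧ ρ V′ ≃ ⟦ φ ⟧ ρ V
    coincide φ g = coincidence φ (λ _ _ → refl) (λ X p t → ≡⇒≃ (cong (λ F → F t) (g X p)))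

    coincide-ctx : ∀ {ρ V V′ Γ Θ} → All (Agree V′ V) Γ → Forces ρ V Γ Θ → Forces ρ V′ Γ Θ
    coincide-ctx g F = All.zipWith (λ {φ} (g , a) → from (coincide φ g) a) (g , F)

    coincide-goal : ∀ {ρ V V′ Π} → MaybeAll.All (Agree V′ V) Π → ⟦ Π ⟧ᴳ ρ V′ ≃ ⟦ Π ⟧ᴳ ρ V
    coincide-goal {Π = just φ} (MaybeAll.just g) = coincide φ g
    coincide-goal MaybeAll.nothing = ≃-refl

    agree-upd : ∀ {V Z C} φ → FreshFor Z φ → Agree (upd V Z C) V φ
    agree-upd φ f X p = upd-fresh (_∈FV φ) f p

    -- An index Δ of an Ω-rule with conclusion Γ ⇒ Π belongs to the interpretation of
    -- its formulas under the canonical valuation only.  Move its variables beyond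
    -- those of Γ ⇒ Π, and let the valuation be canonical there.
    shiftBy : ℕ → Var 0 → Var 0
    shiftBy N (free x) = free (N + x)

    aside : ℕ → (Var 0 → Pred) → Var 0 → Pred
    aside N V (free x) with x <? N
    ... | yes _ = V (free x)
    ... | no  _ = canonical (free (x ∸ N))

    aside-shiftBy : ∀ N V X → aside N V (shiftBy N X) ≡ canonical X
    aside-shiftBy N V (free x) with N + x <? N
    ... | yes p = contradiction p (m+n≮m N x)
    ... | no  _ = cong (canonical ∘ free) (m+n∸m≡n N x)

    aside-below : ∀ {N V} φ → (∀ x → free x ∈FV φ → x < N) → Agree (aside N V) V φ
    aside-below {N} φ b (free x) p with x <? N
    ... | yes _  = refl
    ... | no x≮N = contradiction (b x p) x≮N

    -- An index contained in the antecedent is true there by reflection. Its shifted copy keeps this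
    -- truth under `aside N V`, while `Γ` and `Π` keep their values under `V`, so the premise for
    -- the copy applies.
    Ω∀-sound : ∀ {j B Γ V Θ} Π → j < i →
               (∀ {Δ} → All (λ φ → rank φ ≤ j) Δ → Wit∀ (Prev i j) B Δ →
                  ∀ V {Θ} → Forces var V (Δ ++ Γ) Θ → ⟦ Π ⟧ᴳ var V ∋ Θ) →
               Forces var V Γ Θ → omegaV univ j B ∋ Θ → ⟦ Π ⟧ᴳ var V ∋ Θ
    Ω∀-sound {Γ = Γ} {V} Π r h F c with N , b , b′ ← bounded-sequent bounded-∈FV (Γ ⇒ Π) =
      bind (⟦ Π ⟧ᴳ var V) c λ s (Δ , s′ , a , w) →
        to (coincide-goal (MaybeAll.map (λ {φ} → aside-below φ) b′))
           (h (rename-ranked a) (Wit∀-rename (shiftBy N) w) (aside N V)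
              (All.++⁺ (rename-ctx (All.tabulate λ _ X _ → aside-shiftBy N V X)
                          (reflect-ctx (raise (<⇒≤ r) a) s′))
                       (coincide-ctx (All.map (λ {φ} → aside-below φ) b) (Forces-mono s F))))

    Ω∃-sound : ∀ {j B Γ V Θ} → j < i →
               (∀ {Δ Π} → Ranked j (Δ ⇒ Π) → Wit∃ (Prev i j) B Δ Π →
                  ∀ V {Θ} → Forces var V (Δ ++ Γ) Θ → ⟦ Π ⟧ᴳ var V ∋ Θ) →
               Forces var V Γ Θ → omegaV exis j B ∋ Θ
    Ω∃-sound {Γ = Γ} {V} r h F {Σ} {Π} (a , a′) w s s′
      -- Only `Γ` has to stay below `N`: the goal of the index is shifted with it, and the value of
      -- the quantifier does not depend on `V`.
      with N , b , _ ← bounded-sequent bounded-∈FV (Γ ⇒ nothing) =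
      reify-goal Π (raiseᴳ (<⇒≤ r) a′)
        (to (rename-goal (all-goal Π λ _ X _ → aside-shiftBy N V X))
          (h (rename-ranked a , rename-rankedᴳ Π a′) (Wit∃-rename (shiftBy N) w) (aside N V)
             (All.++⁺ (rename-ctx (All.tabulate λ _ X _ → aside-shiftBy N V X)
                        (reflect-ctx (raise (<⇒≤ r) a) s′))
                      (coincide-ctx (All.map (λ {φ} → aside-below φ) b) (Forces-mono s F)))))

    agree-upd′ : ∀ {V Z C} φ → FreshFor Z φ → Agree V (upd V Z C) φ
    agree-upd′ φ f X p = sym (agree-upd φ f X p)

    mutual
      -- `V` varies in the induction, as Ω-premises are evaluated under `aside` and witnesses under
      -- `upd`. Terms stay fixed at `var`, free term variables being constants here.
      sound : ∀ {Γ Π} → D i Γ Π → ∀ V {Θ} → Forces var V Γ Θ → ⟦ Π ⟧ᴳ var V ∋ Θ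
      sound (weaken s d) V F = sound d V (All.anti-mono s F)
      sound (id m) V F = All.lookup F m
      sound {Π = Π} (⊥L m) V F = bind (⟦ Π ⟧ᴳ var V) (All.lookup F m) λ _ ()
      sound (∧L₁ m d) V F = sound d V (proj₁ (All.lookup F m) ∷ F)
      sound (∧L₂ m d) V F = sound d V (proj₂ (All.lookup F m) ∷ F)
      sound (∧R d e) V F = sound d V F , sound e V F
      sound {Π = Π} (∨L m d e) V F = bind (⟦ Π ⟧ᴳ var V) (All.lookup F m) λ s →
        [ (λ a → sound d V (a ∷ Forces-mono s F)) , (λ a → sound e V (a ∷ Forces-mono s F)) ]
      sound (∨R₁ d) V F Π s k = k ⊆-refl (inj₁ (sound d V (Forces-mono s F)))
      sound (∨R₂ d) V F Π s k = k ⊆-refl (inj₂ (sound d V (Forces-mono s F)))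
      sound (⊃L m d e) V F = sound e V (All.lookup F m ⊆-refl (sound d V F) ∷ F)
      sound (⊃R d) V F s a = sound d V (a ∷ Forces-mono s F)
      sound (∀₁L {φ = φ} m t d) V F =
        sound d V (from (inst-sem φ t) (All.lookup F m (subTerm var t)) ∷ F)
      sound (∀₁R {φ = φ} d) V F t =
        subst (λ u → ⟦ φ ⟧ (var ▹ u) V ∋ _) (subTerm-id t λ _ → refl)
          (to (inst-sem φ t) (sound (d t) V F))
      sound {Π = Π} (∃₁L {φ = φ} m d) V F = bind (⟦ Π ⟧ᴳ var V) (All.lookup F m) λ s (t , a) →
        sound (d t) V
          (from (inst-sem φ t)
             (subst (λ u → ⟦ φ ⟧ (var ▹ u) V ∋ _) (sym (subTerm-id t λ _ → refl)) a)
            ∷ Forces-mono s F)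
      sound (∃₁R {φ = φ} t d) V F Π s k =
        k ⊆-refl (_ , to (inst-sem φ t) (sound d V (Forces-mono s F)))
      sound (∀₂R {ξ = ξ} r w s) V F = ∀₂-intro ξ r (sound∀ ξ w V (All.anti-mono s F))
      sound {Π = Π} (Ω∀ r m h) V F = Ω∀-sound Π r (λ a w → sound (h a w)) F (All.lookup F m)
      -- The witness yields the value that `Ω∀` would have read off from its antecedent.
      sound {Π = Π} (Ω̃∀ ξ ρ r w s h) V F =
        Ω∀-sound Π r (λ a w → sound (h a w)) F (∀₂-intro ξ r (sound∀ ξ w V (All.anti-mono s F)))
      sound {Π = Π} (∃₂L {ξ = ξ} r m w s) V F =
        ∃₂-elim ξ (⟦ Π ⟧ᴳ var V) r (All.lookup F m) λ C s′ →
          sound∃ ξ w V C (Forces-mono s′ (All.anti-mono s F))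
      sound (Ω∃ r h) V F = Ω∃-sound r (λ a w → sound (h a w)) F
      sound {Π = Π} (Ω̃∃ ξ ρ r h w s) V F =
        ∃₂-elim ξ (⟦ Π ⟧ᴳ var V) r (Ω∃-sound r (λ a w → sound (h a w)) F) λ C s′ →
          sound∃ ξ w V C (Forces-mono s′ (All.anti-mono s F))

      -- The stored derivation precedes the renaming by `π`, hence the valuation `V ∘ π`; setting
      -- `Z` to `C` does not disturb the context, where `Z` is fresh.
      sound∀ : ∀ {m k Γ ρ Θ} (ξ : Form m (suc k)) → Wit∀ (D i) (λ Z → opened ρ Z ξ) Γ →
               ∀ V → Forces var V Γ Θ → ∀ C → ⟦ ξ ⟧ ρ (λ _ → C) ∋ Θ
      sound∀ ξ (wit π Z f d) V F C =
        to (opened-sem ξ (upd-same (V ∘ π) Z C))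
          (sound d (upd (V ∘ π) Z C) (unrename-ctx (All.map (λ {φ} → agree-upd′ φ) f) F))

      sound∃ : ∀ {m k Γ Π ρ Θ} (ξ : Form m (suc k)) → Wit∃ (D i) (λ Z → opened ρ Z ξ) Γ Π →
               ∀ V C → Forces var V Γ Θ → ⟦ ξ ⟧ ρ (λ _ → C) ∋ Θ → ⟦ Π ⟧ᴳ var V ∋ Θ
      sound∃ ξ (wit π Z (f , f′) d) V C F a =
        from (rename-goal (MaybeAll.map (λ {φ} → agree-upd′ φ) f′))
          (sound d (upd (V ∘ π) Z C)
            (from (opened-sem ξ (upd-same (V ∘ π) Z C)) a ∷
              unrename-ctx (All.map (λ {φ} → agree-upd′ φ) f) F))

    -- Comprehension: an index embeds into `D i`, whose soundness holds for every value of its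
    -- eigenvariable, and its context is true by reflection.
    ∀₂-elim : ∀ {m k Γ ρ} (ξ : Form m (suc k)) → rank ξ < i →
              omegaV univ (rank ξ) (λ Z → opened ρ Z ξ) ∋ Γ → ∀ C → ⟦ ξ ⟧ ρ (λ _ → C) ∋ Γ
    ∀₂-elim {ρ = ρ} ξ r c C = bind (⟦ ξ ⟧ ρ (λ _ → C)) c λ _ (_ , s , a , w) →
      sound∀ ξ (Wit∀-embed r w) canonical
        (reflect-ctx (raise (<⇒≤ r) a) s) C

    ∃₂-intro : ∀ {m k Γ ρ} (ξ : Form m (suc k)) → rank ξ < i → ∀ C → ⟦ ξ ⟧ ρ (λ _ → C) ∋ Γ →
               omegaV exis (rank ξ) (λ Z → opened ρ Z ξ) ∋ Γ
    ∃₂-intro {ρ = ρ} ξ r C c {Π = Π} (a , a′) w s s′ =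
      reify-goal Π (raiseᴳ (<⇒≤ r) a′)
        (sound∃ ξ (Wit∃-embed r w) canonical C
          (reflect-ctx (raise (<⇒≤ r) a) s′) (mono (⟦ ξ ⟧ ρ (λ _ → C)) s c))

    -- Soundness of LIP

    Valid : Sequent → Set₁
    Valid (Γ ⇒ Π) = ∀ ρ V {Θ} → Forces ρ V Γ Θ → ⟦ Π ⟧ᴳ ρ V ∋ Θ


    coincide-ctx₁ : ∀ {ρ V y t Γ Θ} → All (λ φ → ¬ (free y ∈Fv φ)) Γ →
                    Forces ρ V Γ Θ → Forces (upd ρ y t) V Γ Θ
    coincide-ctx₁ f F = All.zipWith (λ {φ} (f , a) →
      from (coincidence φ (λ _ → upd-fresh (_∈Fv φ) f) (λ _ _ _ → ≃-refl)) a) (f , F)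

    coincide-goal₁ : ∀ {ρ V y t Π} → MaybeAll.All (λ φ → ¬ (free y ∈Fv φ)) Π →
                     ⟦ Π ⟧ᴳ (upd ρ y t) V ≃ ⟦ Π ⟧ᴳ ρ V
    coincide-goal₁ {Π = just φ} (MaybeAll.just f) =
      coincidence φ (λ _ → upd-fresh (_∈Fv φ) f) (λ _ _ _ → ≃-refl)
    coincide-goal₁ MaybeAll.nothing = ≃-refl

    eigen-sem₁ : ∀ {q ρ V y t} (φ : Form 1 0) → ¬ (free y ∈Fv quan₁ q φ) →
                 ⟦ φ [ var (free y) ]₁ ⟧ (upd ρ y t) V ≃ ⟦ φ ⟧ (ρ ▹ t) V
    eigen-sem₁ {q} {ρ} {y = y} {t} φ f = subst₁-sem φ at (λ _ _ _ → ≃-refl)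
      where
      at : ∀ x → x ∈Fv φ → subTerm (upd ρ y t) (fullSubst (single₁ (var (free y))) x) ≡ (ρ ▹ t) x
      at (free x)     p = upd-fresh (_∈Fv quan₁ q φ) f (quan₁ p)
      at (bound zero) p = upd-same ρ y t

    -- By parameter-freeness only the bound variable is looked up, so the constant valuation
    -- suffices on the right.
    eigen-sem₂ : ∀ {n ρ V Y C} {φ : Form 0 1} → FMP n φ → ParameterFree φ →
                 ⟦ φ [ ηAbs (free Y) ]₂ ⟧ ρ (upd V Y C) ≃ ⟦ φ ⟧ ρ (λ _ → C)
    eigen-sem₂ {ρ = ρ} {V} {Y} {C} {φ} a pf = subst₂-sem a at
      where
      at : ∀ X → X ∈FV φ → ∀ t → substEnv (single₂ (ηAbs (free Y))) ρ (upd V Y C) X t ≃ C t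
      at X p t with refl ← pf X p = ≡⇒≃ (cong (λ F → F t) (upd-same V Y C))

    abstract-sem : ∀ {n ρ V τ} {φ : Form 0 1} → FMP n φ → ParameterFree φ →
                   ⟦ φ [ τ ]₂ ⟧ ρ V ≃ ⟦ φ ⟧ ρ (λ _ t → ⟦ τ ⟧ (ρ ▹ t) V)
    abstract-sem {ρ = ρ} {V} {τ} {φ} a pf = subst₂-sem a at
      where
      at : ∀ X → X ∈FV φ → ∀ t → substEnv (single₂ τ) ρ V X t ≃ ⟦ τ ⟧ (ρ ▹ t) V
      at X p t with refl ← pf X p = ≃-refl

    basic-valid : ∀ {Ss S} → Basic Ss S → All Valid Ss → Valid S
    basic-valid id [] ρ V (x ∷ F) = x
    basic-valid {S = _ ⇒ Π} ⊥L [] ρ V (x ∷ F) = bind (⟦ Π ⟧ᴳ ρ V) x λ _ ()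
    basic-valid ⊥R (d ∷ []) ρ V F = d ρ V F
    basic-valid ∧L₁ (d ∷ []) ρ V ((a , b) ∷ F) = d ρ V (a ∷ F)
    basic-valid ∧L₂ (d ∷ []) ρ V ((a , b) ∷ F) = d ρ V (b ∷ F)
    basic-valid ∧R (d ∷ e ∷ []) ρ V F = d ρ V F , e ρ V F
    basic-valid {S = _ ⇒ Π} ∨L (d ∷ e ∷ []) ρ V (x ∷ F) = bind (⟦ Π ⟧ᴳ ρ V) x λ s →
      [ (λ a → d ρ V (a ∷ Forces-mono s F)) , (λ a → e ρ V (a ∷ Forces-mono s F)) ]
    basic-valid ∨R₁ (d ∷ []) ρ V F Π s k = k ⊆-refl (inj₁ (d ρ V (Forces-mono s F)))
    basic-valid ∨R₂ (d ∷ []) ρ V F Π s k = k ⊆-refl (inj₂ (d ρ V (Forces-mono s F)))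
    basic-valid ⊃L (d ∷ e ∷ []) ρ V (x ∷ F) = e ρ V (x ⊆-refl (d ρ V F) ∷ F)
    basic-valid ⊃R (d ∷ []) ρ V F s a = d ρ V (a ∷ Forces-mono s F)
    basic-valid (∀₁L {φ = φ} t) (d ∷ []) ρ V (x ∷ F) =
      d ρ V (from (inst-sem φ t) (x (subTerm ρ t)) ∷ F)
    basic-valid (∀₁R {φ = φ} y (f , MaybeAll.just f′)) (d ∷ []) ρ V F t =
      to (eigen-sem₁ φ f′) (d (upd ρ y t) V (coincide-ctx₁ f F))
    basic-valid {S = _ ⇒ Π} (∃₁L {φ = φ} y (f′ ∷ f , g)) (d ∷ []) ρ V (x ∷ F) =
      bind (⟦ Π ⟧ᴳ ρ V) x λ s (t , a) →
        to (coincide-goal₁ g)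
          (d (upd ρ y t) V (from (eigen-sem₁ φ f′) a ∷ coincide-ctx₁ f (Forces-mono s F)))
    basic-valid (∃₁R {φ = φ} t) (d ∷ []) ρ V F Π s k =
      k ⊆-refl (subTerm ρ t , to (inst-sem φ t) (d ρ V (Forces-mono s F)))

    setQuantifier-valid : ∀ {Ss S} → AllFormulas (FMP i) S → SetQuantifier Ss S →
                          All Valid Ss → Valid S
    setQuantifier-valid (q ∷ _ , _) (∀₂L {φ = φ} τ) (d ∷ []) ρ V (x ∷ F)
      with r , pf , _ , a ← FMP-quan₂ q =
      -- The omitted predicate is the denotation of `τ`, determined by `abstract-sem`.
      d ρ V (from (abstract-sem a pf) (∀₂-elim φ r x _) ∷ F)
    setQuantifier-valid (_ , MaybeAll.just q) (∀₂R {φ = φ} Y (f , _)) (d ∷ []) ρ V F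
      with r , pf , _ , a ← FMP-quan₂ q =
      ∀₂-intro φ r λ C → to (eigen-sem₂ a pf)
        (d ρ (upd V Y C) (coincide-ctx (All.map (λ {φ} → agree-upd φ) f) F))
    setQuantifier-valid {S = _ ⇒ Π} (q ∷ _ , _) (∃₂L {φ = φ} Y (_ ∷ f , g)) (d ∷ []) ρ V (x ∷ F)
      with r , pf , _ , a ← FMP-quan₂ q =
      ∃₂-elim φ (⟦ Π ⟧ᴳ ρ V) r x λ C s c →
        to (coincide-goal (MaybeAll.map (λ {φ} → agree-upd φ) g))
          (d ρ (upd V Y C)
            (from (eigen-sem₂ a pf) c ∷
              coincide-ctx (All.map (λ {φ} → agree-upd φ) f) (Forces-mono s F)))
    setQuantifier-valid (_ , MaybeAll.just q) (∃₂R {φ = φ} τ) (d ∷ []) ρ V F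
      with r , pf , _ , a ← FMP-quan₂ q =
      ∃₂-intro φ r _ (to (abstract-sem a pf) (d ρ V F))

    mutual
      valid : ∀ {S} → Derivation (FMP i) ((Basic ∪ SetQuantifier) ∪ Cut) S → Valid S
      valid (infer (a , b) r (same e) ds) ρ V F =
        rule-valid (All.anti-mono (Equivalence.to e) a , b) r (all-valid ds) ρ V
          (All.anti-mono (Equivalence.to e) F)

      all-valid : ∀ {Ss} → All (Derivation (FMP i) ((Basic ∪ SetQuantifier) ∪ Cut)) Ss →
                  All Valid Ss
      all-valid []       = []
      all-valid (d ∷ ds) = valid d ∷ all-valid ds

      rule-valid : ∀ {Ss S} → AllFormulas (FMP i) S → ((Basic ∪ SetQuantifier) ∪ Cut) Ss S →
                   All Valid Ss → Valid S
      rule-valid a (inj₁ (inj₁ r)) ds = basic-valid r ds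
      rule-valid a (inj₁ (inj₂ r)) ds = setQuantifier-valid a r ds
      rule-valid a (inj₂ (cut φ)) (d ∷ e ∷ []) ρ V F = e ρ V (d ρ V F ∷ F)

    complete : ∀ {Γ Π} → Ranked i (Γ ⇒ Π) → Valid (Γ ⇒ Π) → D i Γ Π
    complete {Π = Π} (a , b) v = reify-goal Π b (v var canonical (reflect-ctx a ⊆-refl))

theorem5p9 : (L : Language) → let open SecondOrder L in
    (i : ℕ) (Γ : List Formula) (Π : Maybe Formula) →
    AllFormulas Fm (Γ ⇒ Π) →
    LIP i ⊢ Γ ⇒ Π → LI ⊢ᶜᶠ Γ ⇒ Π
theorem5p9 L i Γ Π (a , b) d =
  -- Formulas of `LIP i` satisfy `FMP (suc i)` and so have rank at most `suc i`, which fixes the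
  -- level of the model.
  toLI (collapse* (suc i) (complete (raise z≤n a′ , raiseᴳ z≤n b′) (valid d)) (a′ , b′))
       ⊆-refl (a , b)
  where
  open SecondOrder L
  open Development L
  open Semantics (suc i)
  a′ = All.map FMP⇒rank≤ a
  b′ = MaybeAll.map FMP⇒rank≤ b
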